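{- There exists a $6\times 3$ limited augmented bipartite graph $G=(S,T,E_1\cup E_2)$ with total edge count $|E_1|+|E_2|=12$ that satisfies (S), (W1), (W2), (W2') and (W3) (i.e. is weak admissible). Consequently, $$z_{wL}(6,3)\ge 12>11=z_L(6,3),$$ and hence $\mathrm{BSR}(6,3)\ge 12$.
   Context: Notation: $[m]=\{1,\dots,m\}$. An $m\times n$ biquadratic form is a real polynomial $P(\mathbf{x},\mathbf{y})=\sum_{i,k=1}^m\sum_{j,l=1}^n a_{ijkl}x_ix_ky_jy_l$ (with $a_{ijkl}=a_{kjil}=a_{klij}$). It is SOS if $P=\sum_{p=1}^r f_p^2$ with each $f_p$ a real bilinear form in $(\mathbf{x},\mathbf{y})$; the minimum such $r$ is its SOS rank $\mathrm{SOS}(P)$. $\mathrm{BSR}(m,n)$ is the maximum SOS rank among all $m\times n$ SOS biquadratic forms. $z(m,n)$ (the Zarankiewicz number) is the maximum number of edges of an $m\times n$ bipartite graph with no $C_4$. Augmented bipartite graphs $G=(S,T,E_1\cup E_2)$, $S=[m]$, $T=[n]$. A cell is a pair $(i,j)\in[m]\times[n]$ ($i$ is its row, $j$ its column). A 1-edge is a cell; $E_1$ is a set of 1-edges, viewed as a bipartite graph $G_1$ on $S,T$. A 2-edge is an unordered pair of distinct cells, written $(i,j;k,l)$; the cells $(i,j)$ and $(k,l)$ are its two halves. It is nondegenerate if $i\ne k$ and $j\ne l$, row-degenerate if $i=k$ and $j\neq l$, column-degenerate if $i\ne k$ and $j=l$. $E_2$ is a set of 2-edges. $G$ is called limited if $|E_1|=z(m,n)$.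 A cell is occupied if it is in $E_1$ or is a half of some 2-edge in $E_2$; otherwise it is unoccupied. The opposite cells of a nondegenerate 2-edge $(i,j;k,l)$ are $(i,l)$ and $(k,j)$. Two nondegenerate 2-edges of the form $(i,j;k,l)$ and $(i,l;k,j)$ are called complementary. The dependency graph $\mathcal{D}$ is the directed graph whose vertices are the nondegenerate 2-edges in $E_2$, with an arc $e\to e'$ ($e\ne e'$) if both opposite cells of $e$ are occupied and one half of $e'$ is an opposite cell of $e$. An edge's row (column) set is the set of rows (columns) of its cell (1-edge) or of its halves (2-edge). Two edges are vertex-disjoint if their row sets are disjoint and their column sets are disjoint. The opposite cells of a vertex-disjoint pair $e,f$ are the cells formed by a row of one of the two edges and a column of the other. For a 1-edge $(i,j)$ and a 2-edge $(k,l;p,q)$ they are $(i,l),(i,q),(k,j),(p,j)$. Conditions: (S) No 2-edge shares a cell with any 1-edge or with any other 2-edge. (W1) $G_1$ contains no $C_4$. (W2) $\mathcal{D}$ contains no directed cycle other than 2-cycles formed by a pair of complementary 2-edges (which are allowed). (W2') There is no nondegenerate 2-edge in $E_2$ whose two opposite cells are both 1-edges. (W3) For every vertex-disjoint pair of edges of $G$ at least one of which is a 2-edge, at least one of the opposite cells of the pair is unoccupied. $z_{wL}(m,n)$ is the maximum of $|E_1|+|E_2|$ over all limited $G$ satisfying (S), (W1), (W2), (W2'), (W3). $z_L(m,n)$ (the limited augmented Zarankiewicz number) is the maximum of $|E_1|+|E_2|$ over all limited $G$ satisfying (S), (W1), and the two original conditions: (Condition 2) no nondegenerate 2-edge in $E_2$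 has both of its opposite cells occupied; (Condition 3) there are no 2-edge $(i,j;p,q)\in E_2$ and cell $(k,l)$ with $k\notin\{i,p\}$, $l\notin\{j,q\}$ such that all of the cells $(k,l),(k,j),(k,q),(i,l),(p,l)$ are occupied. -}

module Defs where

open import Algebra.Bundles using (CommutativeRing)
open import Algebra.Structures using (IsCommutativeRing)
open import Data.Fin.Base using (Fin)
open import Data.Fin.Subset using (Subset; _∈_)
import Data.Fin.Subset as Subset
open import Data.List.Base using (List; []; _∷_; _++_; [_]; length)
import Data.List.Membership.Propositional as List
open import Data.List.Relation.Unary.AllPairs using (AllPairs)
open import Data.List.Relation.Unary.Linked using (Linked)
open import Data.Nat.Base as ℕ using (ℕ; _⊔_)
import Data.Nat.Properties as ℕ
open import Data.Product.Base using (∃; ∃₂; _×_; _,_; proj₁; proj₂)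
open import Data.Rational.Base as ℚ using (ℚ; 0ℚ; 1ℚ; ½; 1/_; Positive)
import Data.Rational.Properties as ℚ
open import Data.Rational.Solver using (module +-*-Solver)
open import Data.Sum.Base using (_⊎_; inj₁; inj₂)
open import Data.Vec.Base as Vec using (Vec; lookup)
open import Data.Vec.Functional using (Vector)
open import Level using (0ℓ)
open import Relation.Binary.PropositionalEquality using (_≡_; _≢_; refl; sym; trans; cong; subst)
open import Relation.Binary.Structures using (IsEquivalence)
open import Relation.Nullary using (¬_)

IsMaximum : (ℕ → Set) → ℕ → Set
IsMaximum A k = A k × (∀ l → A l → l ℕ.≤ k)

IsMinimum : (ℕ → Set) → ℕ → Set
IsMinimum A k = A k × (∀ l → A l → k ℕ.≤ l)

-- Reals are Cauchy sequences of rationals.  Taking m and n independently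
-- makes x ∼ x the Cauchy condition; on Cauchy sequences, x ∼ y says that
-- x - y tends to 0.
infix 4 _∼_
record _∼_ (x y : ℕ → ℚ) : Set where
  constructor mk∼
  field
    close : ∀ ε → 0ℚ ℚ.< ε → ∃ λ N → ∀ m n → N ℕ.≤ m → N ℕ.≤ n → ℚ.∣ x m ℚ.- y n ∣ ℚ.< ε

open _∼_ public

record ℝ : Set where
  constructor mkℝ
  field
    seq    : ℕ → ℚ
    cauchy : seq ∼ seq

open ℝ public

module CauchySequences where

  open +-*-Solver using (solve; _:+_; _:*_; :-_; _:-_; _:=_)

  0<½ε : ∀ {ε} → 0ℚ ℚ.< ε → 0ℚ ℚ.< ½ ℚ.* ε
  0<½ε {ε} 0<ε = subst (ℚ._< ½ ℚ.* ε) (ℚ.*-zeroʳ ½) (ℚ.*-monoʳ-<-pos ½ 0<ε)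

  ½+½ : ∀ ε → ½ ℚ.* ε ℚ.+ ½ ℚ.* ε ≡ ε
  ½+½ ε = trans (sym (ℚ.*-distribʳ-+ ε ½ ½)) (ℚ.*-identityˡ ε)

  ∣-∣-sym : ∀ p q → ℚ.∣ p ℚ.- q ∣ ≡ ℚ.∣ q ℚ.- p ∣
  ∣-∣-sym p q = trans (cong ℚ.∣_∣ (solve 2 (λ p q → p :- q := :- (q :- p)) refl p q)) (ℚ.∣-p∣≡∣p∣ (q ℚ.- p))

  ∣+∣< : ∀ p q {ε} → ℚ.∣ p ∣ ℚ.< ½ ℚ.* ε → ℚ.∣ q ∣ ℚ.< ½ ℚ.* ε → ℚ.∣ p ℚ.+ q ∣ ℚ.< ε
  ∣+∣< p q {ε} a b = subst (ℚ.∣ p ℚ.+ q ∣ ℚ.<_) (½+½ ε) (ℚ.≤-<-trans (ℚ.∣p+q∣≤∣p∣+∣q∣ p q) (ℚ.+-mono-< a b))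

  ∼-sym : ∀ {x y} → x ∼ y → y ∼ x
  ∼-sym {x} {y} x∼y .close ε 0<ε with N , h ← x∼y .close ε 0<ε =
    N , λ m n N≤m N≤n → subst (ℚ._< ε) (∣-∣-sym (x n) (y m)) (h n m N≤n N≤m)

  ∼-trans : ∀ {x y z} → x ∼ y → y ∼ z → x ∼ z
  ∼-trans {x} {y} {z} x∼y y∼z .close ε 0<ε
    with N , h ← x∼y .close (½ ℚ.* ε) (0<½ε 0<ε) | M , k ← y∼z .close (½ ℚ.* ε) (0<½ε 0<ε) =
    N ⊔ M , λ m n ≤m ≤n → let l = N ⊔ M in
      subst (λ p → ℚ.∣ p ∣ ℚ.< ε)
        (solve 3 (λ a b c → (a :- b) :+ (b :- c) := a :- c) refl (x m) (y l) (z n))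
        (∣+∣< (x m ℚ.- y l) (y l ℚ.- z n)
          (h m l (ℕ.m⊔n≤o⇒m≤o N M ≤m) (ℕ.m≤m⊔n N M))
          (k l n (ℕ.m≤n⊔m N M) (ℕ.m⊔n≤o⇒n≤o N M ≤n)))

  ∼-pointwise : ∀ {x y} → (∀ n → x n ≡ y n) → x ∼ x → x ∼ y
  ∼-pointwise {x} x≡y x∼x .close ε 0<ε with N , h ← x∼x .close ε 0<ε =
    N , λ m n ≤m ≤n → subst (λ p → ℚ.∣ x m ℚ.- p ∣ ℚ.< ε) (x≡y n) (h m n ≤m ≤n)

  ∼-const : ∀ q → (λ _ → q) ∼ (λ _ → q)
  ∼-const q .close ε 0<ε = 0 , λ _ _ _ _ → subst (λ p → ℚ.∣ p ∣ ℚ.< ε) (sym (ℚ.+-inverseʳ q)) 0<ε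

  +-cong-∼ : ∀ {x x′ y y′} → x ∼ x′ → y ∼ y′ → (λ n → x n ℚ.+ y n) ∼ (λ n → x′ n ℚ.+ y′ n)
  +-cong-∼ {x} {x′} {y} {y′} x∼x′ y∼y′ .close ε 0<ε
    with N , h ← x∼x′ .close (½ ℚ.* ε) (0<½ε 0<ε) | M , k ← y∼y′ .close (½ ℚ.* ε) (0<½ε 0<ε) =
    N ⊔ M , λ m n ≤m ≤n →
      subst (λ p → ℚ.∣ p ∣ ℚ.< ε)
        (solve 4 (λ a b c d → (a :- b) :+ (c :- d) := (a :+ c) :- (b :+ d)) refl (x m) (x′ n) (y m) (y′ n))
        (∣+∣< (x m ℚ.- x′ n) (y m ℚ.- y′ n)
          (h m n (ℕ.m⊔n≤o⇒m≤o N M ≤m) (ℕ.m⊔n≤o⇒m≤o N M ≤n))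
          (k m n (ℕ.m⊔n≤o⇒n≤o N M ≤m) (ℕ.m⊔n≤o⇒n≤o N M ≤n)))

  neg-cong-∼ : ∀ {x y} → x ∼ y → (λ n → ℚ.- x n) ∼ (λ n → ℚ.- y n)
  neg-cong-∼ {x} {y} x∼y .close ε 0<ε with N , h ← x∼y .close ε 0<ε =
    N , λ m n ≤m ≤n → subst (ℚ._< ε)
      (trans (∣-∣-sym (x m) (y n)) (cong ℚ.∣_∣ (solve 2 (λ a b → b :- a := (:- a) :- (:- b)) refl (x m) (y n))))
      (h m n ≤m ≤n)

  bounded : ∀ {x y} → x ∼ y → ∃ λ B → Positive B × ∃ λ N → ∀ m → N ℕ.≤ m → ℚ.∣ x m ∣ ℚ.≤ B
  bounded {x} {y} x∼y with N , h ← x∼y .close 1ℚ (ℚ.positive⁻¹ 1ℚ) =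
    1ℚ ℚ.+ ℚ.∣ y N ∣ ,
    ℚ.pos+nonNeg⇒pos 1ℚ ℚ.∣ y N ∣ {{ℚ.∣-∣-nonNeg (y N)}} ,
    N , λ m N≤m → begin
      ℚ.∣ x m ∣                            ≡⟨ cong ℚ.∣_∣ (solve 2 (λ a b → a := (a :- b) :+ b) refl (x m) (y N)) ⟩
      ℚ.∣ (x m ℚ.- y N) ℚ.+ y N ∣          ≤⟨ ℚ.∣p+q∣≤∣p∣+∣q∣ (x m ℚ.- y N) (y N) ⟩
      ℚ.∣ x m ℚ.- y N ∣ ℚ.+ ℚ.∣ y N ∣      ≤⟨ ℚ.+-monoˡ-≤ ℚ.∣ y N ∣ (ℚ.<⇒≤ (h m N N≤m ℕ.≤-refl)) ⟩
      1ℚ ℚ.+ ℚ.∣ y N ∣                     ∎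
    where open ℚ.≤-Reasoning

  scaled : ∀ B → Positive B → ∀ {ε} → 0ℚ ℚ.< ε →
           ∃ λ δ → 0ℚ ℚ.< δ × (∀ p q → ℚ.∣ p ∣ ℚ.≤ B → ℚ.∣ q ∣ ℚ.< δ → ℚ.∣ p ℚ.* q ∣ ℚ.< ε)
  scaled B B>0 {ε} 0<ε = δ , 0<δ , λ p q ∣p∣≤B ∣q∣<δ → begin-strict
      ℚ.∣ p ℚ.* q ∣           ≡⟨ ℚ.∣p*q∣≡∣p∣*∣q∣ p q ⟩
      ℚ.∣ p ∣ ℚ.* ℚ.∣ q ∣     ≤⟨ ℚ.*-monoʳ-≤-nonNeg ℚ.∣ q ∣ {{ℚ.∣-∣-nonNeg q}} ∣p∣≤B ⟩
      B ℚ.* ℚ.∣ q ∣           <⟨ ℚ.*-monoʳ-<-pos B ∣q∣<δ ⟩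
      B ℚ.* (1/ B ℚ.* ε)      ≡⟨ sym (ℚ.*-assoc B (1/ B) ε) ⟩
      (B ℚ.* 1/ B) ℚ.* ε      ≡⟨ cong (ℚ._* ε) (ℚ.*-inverseʳ B) ⟩
      1ℚ ℚ.* ε                ≡⟨ ℚ.*-identityˡ ε ⟩
      ε                       ∎
    where
    open ℚ.≤-Reasoning
    instance
      B-positive : Positive B
      B-positive = B>0
      B-nonZero : ℚ.NonZero B
      B-nonZero = ℚ.pos⇒nonZero B
    δ = 1/ B ℚ.* ε
    0<δ : 0ℚ ℚ.< δ
    0<δ = subst (ℚ._< δ) (ℚ.*-zeroʳ (1/ B)) (ℚ.*-monoʳ-<-pos (1/ B) {{ℚ.1/pos⇒pos B}} 0<ε)

  difference-* : ∀ a b c d → a ℚ.* (c ℚ.- d) ℚ.+ d ℚ.* (a ℚ.- b) ≡ a ℚ.* c ℚ.- b ℚ.* d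
  difference-* = solve 4 (λ a b c d → a :* (c :- d) :+ d :* (a :- b) := a :* c :- b :* d) refl

  *-cong-∼ : ∀ {x x′ y y′} → x ∼ x′ → y ∼ y′ → (λ n → x n ℚ.* y n) ∼ (λ n → x′ n ℚ.* y′ n)
  *-cong-∼ {x} {x′} {y} {y′} x∼x′ y∼y′ .close ε 0<ε =
    from-bounds (bounded x∼x′) (bounded (∼-sym y∼y′))
    where
    Bound : (ℕ → ℚ) → Set
    Bound z = ∃ λ B → Positive B × ∃ λ N → ∀ m → N ℕ.≤ m → ℚ.∣ z m ∣ ℚ.≤ B
    Modulus : ℚ → Set
    Modulus B = ∃ λ δ → 0ℚ ℚ.< δ × (∀ p q → ℚ.∣ p ∣ ℚ.≤ B → ℚ.∣ q ∣ ℚ.< δ → ℚ.∣ p ℚ.* q ∣ ℚ.< ½ ℚ.* ε)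
    Close : (ℕ → ℚ) → (ℕ → ℚ) → ℚ → Set
    Close z w δ = ∃ λ N → ∀ m n → N ℕ.≤ m → N ℕ.≤ n → ℚ.∣ z m ℚ.- w n ∣ ℚ.< δ
    Goal : Set
    Goal = Close (λ n → x n ℚ.* y n) (λ n → x′ n ℚ.* y′ n) ε
    from-bounds : Bound x → Bound y′ → Goal
    from-bounds (B , B>0 , N₁ , x≤B) (C , C>0 , N₂ , y′≤C) =
      from-moduli (scaled B B>0 (0<½ε 0<ε)) (scaled C C>0 (0<½ε 0<ε))
      where
      from-moduli : Modulus B → Modulus C → Goal
      from-moduli (δ , 0<δ , f) (η , 0<η , g) = from-close (x∼x′ .close η 0<η) (y∼y′ .close δ 0<δ)
        where
        from-close : Close x x′ η → Close y y′ δ → Goal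
        from-close (N₃ , h) (N₄ , k) = N , λ m n ≤m ≤n →
          subst (λ p → ℚ.∣ p ∣ ℚ.< ε) (difference-* (x m) (x′ n) (y m) (y′ n))
            (∣+∣< (x m ℚ.* (y m ℚ.- y′ n)) (y′ n ℚ.* (x m ℚ.- x′ n))
              (f (x m) (y m ℚ.- y′ n) (x≤B m (ℕ.≤-trans N₁≤N ≤m)) (k m n (ℕ.≤-trans N₄≤N ≤m) (ℕ.≤-trans N₄≤N ≤n)))
              (g (y′ n) (x m ℚ.- x′ n) (y′≤C n (ℕ.≤-trans N₂≤N ≤n)) (h m n (ℕ.≤-trans N₃≤N ≤m) (ℕ.≤-trans N₃≤N ≤n))))
          where
          N : ℕ
          N = (N₁ ⊔ N₂) ⊔ (N₃ ⊔ N₄)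
          N₁≤N : N₁ ℕ.≤ N
          N₁≤N = ℕ.≤-trans (ℕ.m≤m⊔n N₁ N₂) (ℕ.m≤m⊔n (N₁ ⊔ N₂) (N₃ ⊔ N₄))
          N₂≤N : N₂ ℕ.≤ N
          N₂≤N = ℕ.≤-trans (ℕ.m≤n⊔m N₁ N₂) (ℕ.m≤m⊔n (N₁ ⊔ N₂) (N₃ ⊔ N₄))
          N₃≤N : N₃ ℕ.≤ N
          N₃≤N = ℕ.≤-trans (ℕ.m≤m⊔n N₃ N₄) (ℕ.m≤n⊔m (N₁ ⊔ N₂) (N₃ ⊔ N₄))
          N₄≤N : N₄ ℕ.≤ N
          N₄≤N = ℕ.≤-trans (ℕ.m≤n⊔m N₃ N₄) (ℕ.m≤n⊔m (N₁ ⊔ N₂) (N₃ ⊔ N₄))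

infix  4 _≈_
infixl 6 _+_
infixl 7 _*_
infix  8 -_

record _≈_ (x y : ℝ) : Set where
  constructor mk≈
  field
    seq-∼ : seq x ∼ seq y

open _≈_ public

fromℚ : ℚ → ℝ
fromℚ q = mkℝ (λ _ → q) (CauchySequences.∼-const q)

0ℝ 1ℝ : ℝ
0ℝ = fromℚ 0ℚ
1ℝ = fromℚ 1ℚ

_+_ _*_ : ℝ → ℝ → ℝ
x + y = mkℝ (λ n → seq x n ℚ.+ seq y n) (CauchySequences.+-cong-∼ (cauchy x) (cauchy y))
x * y = mkℝ (λ n → seq x n ℚ.* seq y n) (CauchySequences.*-cong-∼ (cauchy x) (cauchy y))

-_ : ℝ → ℝ
- x = mkℝ (λ n → ℚ.- seq x n) (CauchySequences.neg-cong-∼ (cauchy x))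

pointwise : ∀ x y → (∀ n → seq x n ≡ seq y n) → x ≈ y
pointwise x y x≡y = mk≈ (CauchySequences.∼-pointwise x≡y (cauchy x))

≈-isEquivalence : IsEquivalence _≈_
≈-isEquivalence = record
  { refl  = λ {x} → mk≈ (cauchy x)
  ; sym   = λ p → mk≈ (CauchySequences.∼-sym (seq-∼ p))
  ; trans = λ p q → mk≈ (CauchySequences.∼-trans (seq-∼ p) (seq-∼ q))
  }

ℝ-isCommutativeRing : IsCommutativeRing _≈_ _+_ _*_ -_ 0ℝ 1ℝ
ℝ-isCommutativeRing = record
  { isRing = record
    { +-isAbelianGroup = record
      { isGroup = record
        { isMonoid = record
          { isSemigroup = record
            { isMagma = record
              { isEquivalence = ≈-isEquivalence
              ; ∙-cong        = λ p q → mk≈ (CauchySequences.+-cong-∼ (seq-∼ p) (seq-∼ q))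
              }
            ; assoc = λ x y z → pointwise ((x + y) + z) (x + (y + z)) (λ n → ℚ.+-assoc (seq x n) (seq y n) (seq z n))
            }
          ; identity = (λ x → pointwise (0ℝ + x) x (λ n → ℚ.+-identityˡ (seq x n)))
                     , (λ x → pointwise (x + 0ℝ) x (λ n → ℚ.+-identityʳ (seq x n)))
          }
        ; inverse = (λ x → pointwise (- x + x) 0ℝ (λ n → ℚ.+-inverseˡ (seq x n)))
                  , (λ x → pointwise (x + - x) 0ℝ (λ n → ℚ.+-inverseʳ (seq x n)))
        ; ⁻¹-cong = λ p → mk≈ (CauchySequences.neg-cong-∼ (seq-∼ p))
        }
      ; comm = λ x y → pointwise (x + y) (y + x) (λ n → ℚ.+-comm (seq x n) (seq y n))
      }
    ; *-cong     = λ p q → mk≈ (CauchySequences.*-cong-∼ (seq-∼ p) (seq-∼ q))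
    ; *-assoc    = λ x y z → pointwise ((x * y) * z) (x * (y * z)) (λ n → ℚ.*-assoc (seq x n) (seq y n) (seq z n))
    ; *-identity = (λ x → pointwise (1ℝ * x) x (λ n → ℚ.*-identityˡ (seq x n)))
                 , (λ x → pointwise (x * 1ℝ) x (λ n → ℚ.*-identityʳ (seq x n)))
    ; distrib    = (λ x y z → pointwise (x * (y + z)) (x * y + x * z) (λ n → ℚ.*-distribˡ-+ (seq x n) (seq y n) (seq z n)))
                 , (λ x y z → pointwise ((y + z) * x) (y * x + z * x) (λ n → ℚ.*-distribʳ-+ (seq x n) (seq y n) (seq z n)))
    }
  ; *-comm = λ x y → pointwise (x * y) (y * x) (λ n → ℚ.*-comm (seq x n) (seq y n))
  }

ℝ-commutativeRing : CommutativeRing 0ℓ 0ℓ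
ℝ-commutativeRing = record { isCommutativeRing = ℝ-isCommutativeRing }

open import Algebra.Properties.Monoid.Sum
  (CommutativeRing.+-monoid ℝ-commutativeRing) public using (sum; sum-syntax)

-- coeff i j k l is the coefficient a_{ijkl} of x_i x_k y_j y_l.
record BiquadraticForm (m n : ℕ) : Set where
  field
    coeff : Fin m → Fin n → Fin m → Fin n → ℝ
    sym₁  : ∀ i j k l → coeff i j k l ≈ coeff k j i l
    sym₂  : ∀ i j k l → coeff i j k l ≈ coeff k l i j

BilinearForm : ℕ → ℕ → Set
BilinearForm m n = Fin m → Fin n → ℝ

evalBiquadratic : ∀ {m n} → BiquadraticForm m n → Vector ℝ m → Vector ℝ n → ℝ
evalBiquadratic {m} {n} P x y =
  ∑[ i < m ] ∑[ k < m ] ∑[ j < n ] ∑[ l < n ] (coeff i j k l * x i * x k * y j * y l)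
  where open BiquadraticForm P

evalBilinear : ∀ {m n} → BilinearForm m n → Vector ℝ m → Vector ℝ n → ℝ
evalBilinear {m} {n} f x y = ∑[ i < m ] ∑[ j < n ] (f i j * x i * y j)

-- Polynomials over the infinite field ℝ are equal when their values are.
IsSumOfSquares : ∀ {m n} → BiquadraticForm m n → ℕ → Set
IsSumOfSquares {m} {n} P r =
  ∃ λ (f : Fin r → BilinearForm m n) → ∀ x y →
    evalBiquadratic P x y ≈ ∑[ p < r ] (evalBilinear (f p) x y * evalBilinear (f p) x y)

IsSOSRank : ∀ {m n} → BiquadraticForm m n → ℕ → Set
IsSOSRank P = IsMinimum (IsSumOfSquares P)

-- Having an SOS rank entails being SOS.
IsBSR : ℕ → ℕ → ℕ → Set
IsBSR m n = IsMaximum (λ r → ∃ λ (P : BiquadraticForm m n) → IsSOSRank P r)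

Cell : ℕ → ℕ → Set
Cell m n = Fin m × Fin n

row : ∀ {m n} → Cell m n → Fin m
row = proj₁

col : ∀ {m n} → Cell m n → Fin n
col = proj₂

-- The i-th entry is the neighbourhood of i ∈ S in T.
BipartiteGraph : ℕ → ℕ → Set
BipartiteGraph m n = Vec (Subset n) m

infix 4 _∈ᴳ_
_∈ᴳ_ : ∀ {m n} → Cell m n → BipartiteGraph m n → Set
(i , j) ∈ᴳ G = j ∈ lookup G i

edgeCount : ∀ {m n} → BipartiteGraph m n → ℕ
edgeCount G = Vec.sum (Vec.map Subset.∣_∣ G)

C₄-Free : ∀ {m n} → BipartiteGraph m n → Set
C₄-Free G = ¬ (∃₂ λ i k → ∃₂ λ j l → i ≢ k × j ≢ l ×
  (i , j) ∈ᴳ G × (i , l) ∈ᴳ G × (k , j) ∈ᴳ G × (k , l) ∈ᴳ G)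

IsZarankiewicz : ℕ → ℕ → ℕ → Set
IsZarankiewicz m n =
  IsMaximum (λ k → ∃ λ (G : BipartiteGraph m n) → C₄-Free G × edgeCount G ≡ k)

-- A 2-edge with an arbitrary ordering of its halves; SameEdge forgets it.
record TwoEdge (m n : ℕ) : Set where
  constructor twoEdge
  field
    half₁ half₂ : Cell m n
    .distinct   : half₁ ≢ half₂

open TwoEdge public

module _ {m n : ℕ} where

  SameEdge : TwoEdge m n → TwoEdge m n → Set
  SameEdge e f = (half₁ e ≡ half₁ f × half₂ e ≡ half₂ f)
               ⊎ (half₁ e ≡ half₂ f × half₂ e ≡ half₁ f)

  HalfOf : TwoEdge m n → Cell m n → Set
  HalfOf e c = c ≡ half₁ e ⊎ c ≡ half₂ e

  Nondegenerate : TwoEdge m n → Set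
  Nondegenerate e = row (half₁ e) ≢ row (half₂ e) × col (half₁ e) ≢ col (half₂ e)

  opposite₁ opposite₂ : TwoEdge m n → Cell m n
  opposite₁ e = row (half₁ e) , col (half₂ e)
  opposite₂ e = row (half₂ e) , col (half₁ e)

  Complementary : TwoEdge m n → TwoEdge m n → Set
  Complementary e f = Nondegenerate e × Nondegenerate f ×
    ( (half₁ f ≡ opposite₁ e × half₂ f ≡ opposite₂ e)
    ⊎ (half₁ f ≡ opposite₂ e × half₂ f ≡ opposite₁ e))

record AugmentedGraph (m n : ℕ) : Set where
  field
    E₁       : BipartiteGraph m n
    E₂       : List (TwoEdge m n)
    E₂-isSet : AllPairs (λ e f → ¬ SameEdge e f) E₂

module _ {m n : ℕ} (G : AugmentedGraph m n) where

  open AugmentedGraph G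

  totalEdges : ℕ
  totalEdges = edgeCount E₁ ℕ.+ length E₂

  Limited : Set
  Limited = IsZarankiewicz m n (edgeCount E₁)

  Occupied : Cell m n → Set
  Occupied c = c ∈ᴳ E₁ ⊎ (∃ λ e → e List.∈ E₂ × HalfOf e c)

  OppositesOccupied : TwoEdge m n → Set
  OppositesOccupied e = Occupied (opposite₁ e) × Occupied (opposite₂ e)

  record DependencyArc (e f : TwoEdge m n) : Set where
    field
      source∈E₂         : e List.∈ E₂
      target∈E₂         : f List.∈ E₂
      source-nondeg     : Nondegenerate e
      target-nondeg     : Nondegenerate f
      different         : ¬ SameEdge e f
      opposites-occ     : OppositesOccupied e
      opposite-is-half  : HalfOf f (opposite₁ e) ⊎ HalfOf f (opposite₂ e)

  -- The directed cycle e → … → e whose (distinct) vertices are e ∷ es.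
  IsDirectedCycle : TwoEdge m n → List (TwoEdge m n) → Set
  IsDirectedCycle e es = AllPairs (λ f g → ¬ SameEdge f g) (e ∷ es) × Linked DependencyArc (e ∷ es ++ [ e ])

  Edge : Set
  Edge = (∃ λ c → c ∈ᴳ E₁) ⊎ (∃ λ e → e List.∈ E₂)

  CellOf : Edge → Cell m n → Set
  CellOf (inj₁ (c , _)) d = d ≡ c
  CellOf (inj₂ (e , _)) d = HalfOf e d

  RowOf : Edge → Fin m → Set
  RowOf e i = ∃ λ c → CellOf e c × row c ≡ i

  ColOf : Edge → Fin n → Set
  ColOf e j = ∃ λ c → CellOf e c × col c ≡ j

  VertexDisjoint : Edge → Edge → Set
  VertexDisjoint e f = (∀ i → ¬ (RowOf e i × RowOf f i)) × (∀ j → ¬ (ColOf e j × ColOf f j))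

  OppositeCell : Edge → Edge → Cell m n → Set
  OppositeCell e f c = (RowOf e (row c) × ColOf f (col c)) ⊎ (RowOf f (row c) × ColOf e (col c))

  CondS : Set
  CondS = (∀ e → e List.∈ E₂ → ∀ c → HalfOf e c → ¬ (c ∈ᴳ E₁))
        × (∀ e f → e List.∈ E₂ → f List.∈ E₂ → ¬ SameEdge e f → ∀ c → HalfOf e c → ¬ HalfOf f c)

  CondW1 : Set
  CondW1 = C₄-Free E₁

  CondW2 : Set
  CondW2 = ∀ e es → IsDirectedCycle e es → ∃ λ f → es ≡ [ f ] × Complementary e f

  CondW2′ : Set
  CondW2′ = ¬ (∃ λ e → e List.∈ E₂ × Nondegenerate e × opposite₁ e ∈ᴳ E₁ × opposite₂ e ∈ᴳ E₁)

  -- Vertex-disjointness and opposite cells are symmetric in the pair, so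
  -- the 2-edge it must contain can be put first.
  CondW3 : Set
  CondW3 = ∀ e (e∈E₂ : e List.∈ E₂) (f : Edge) → let e′ = inj₂ (e , e∈E₂) in
    VertexDisjoint e′ f → ∃ λ c → OppositeCell e′ f c × ¬ Occupied c

  WeakAdmissible : Set
  WeakAdmissible = CondS × CondW1 × CondW2 × CondW2′ × CondW3

  Condition2 : Set
  Condition2 = ¬ (∃ λ e → e List.∈ E₂ × Nondegenerate e × OppositesOccupied e)

  Condition3 : Set
  Condition3 = ¬ (∃ λ e → e List.∈ E₂ × ∃₂ λ k l →
    let (i , j) = half₁ e ; (p , q) = half₂ e in
    k ≢ i × k ≢ p × l ≢ j × l ≢ q ×
    Occupied (k , l) × Occupied (k , j) × Occupied (k , q) × Occupied (i , l) × Occupied (p , l))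

  Admissible : Set
  Admissible = CondS × CondW1 × Condition2 × Condition3

Is-zwL : ℕ → ℕ → ℕ → Set
Is-zwL m n = IsMaximum (λ k →
  ∃ λ (G : AugmentedGraph m n) → Limited G × WeakAdmissible G × totalEdges G ≡ k)

Is-zL : ℕ → ℕ → ℕ → Set
Is-zL m n = IsMaximum (λ k →
  ∃ λ (G : AugmentedGraph m n) → Limited G × Admissible G × totalEdges G ≡ k)

{-# OPTIONS --safe #-}
module Submission where

-- A C₄-free graph with m rows and three columns has at most m + 3 edges: a row
-- of degree d satisfies d ≤ 1 + d(d-1)/2, and each of the three pairs of columns
-- occurs in at most one row.
-- So a limited 6 × 3 graph has one row for each pair and three rows of one
-- 1-edge, and nine cells are left for the 2-edges.
--
-- Four 2-edges would leave a single unoccupied cell.  Two rows with two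
-- 1-edges then give contradictory unoccupied cells through (W3) unless every
-- 2-edge has a half in such a row, which has room for only one half; there are
-- only three of these rows.  Under Condition 3, once at most three cells are
-- unoccupied, the row of each half holds an unoccupied cell besides a 1-edge,
-- hence only that half; three 2-edges would thus require six unoccupied cells.
--
-- In any representation of the form of the 12-edge graph as Σ f_p², let v_c be
-- the vector of the coefficients of the f_p at the cell c.  Comparing
-- coefficients gives v_ij · v_kl + v_il · v_kj for all i, j, k, l.  It
-- follows that v_c = 0 on unoccupied cells, that the two halves of a 2-edge
-- have the same vector, and that the vectors of the 12 edges are orthonormal,
-- so there are at least 12 forms f_p.

open import Defs hiding (_+_; _*_; -_; _≈_; sum; sum-syntax)
open import Data.Nat.Base using (_≥_; _>_)
open import Data.Product.Base using (∃; ∃₂; _×_)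
open import Relation.Binary.PropositionalEquality using (_≡_)

open import Algebra.Bundles using (CommutativeRing)
open import Algebra.Core using (Op₁; Op₂)
open import Algebra.Structures using (IsCommutativeRing)
open import Data.Fin.Base using (Fin; zero; suc)
open import Data.Maybe.Base using (Maybe; just; nothing; maybe′)
open import Data.Nat.Base as ℕ using (ℕ; zero; suc)
import Data.Nat.Properties as ℕ
open import Data.Product.Base using (proj₁; proj₂; _,_)
open import Data.Rational.Base as ℚ using (0ℚ; 1ℚ; ½)
import Data.Rational.Properties as ℚ
open import Data.Sum.Base using (_⊎_; inj₁; inj₂)
open import Data.Vec.Functional using (Vector; foldr; zipWith)
open import Level using (_⊔_)
open import Relation.Binary.Core using (Rel)
import Relation.Binary.PropositionalEquality as ≡
open import Relation.Nullary using (¬_)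

-- Sums of squares of bilinear forms

corner : ∀ {m n} → Cell m n → Cell m n → Cell m n
corner c d = row c , col d

-- With blank cells as `Free`, this makes the product of two coefficient vectors known; with
-- unoccupied cells, it yields what (W3) asks of two edges.
Separated : ∀ {m n} → (Cell m n → Set) → Cell m n → Cell m n → Set
Separated Free c d = row c ≡ row d ⊎ col c ≡ col d ⊎ Free (corner c d) ⊎ Free (corner d c)

-- A labelling stands for the sum over all labels of the squares of
-- Σ x_i y_j, the sum over the cells (i , j) with that label.  Write v_c for the
-- vector of coefficients at the cell c in another representation as a sum of
-- squares.  Linked cells have equal vectors, and Determined c d is a reason
-- why v_c · v_d is the same in both representations.
module Labelling {m n N : ℕ} (label : Cell m n → Maybe (Fin N)) where

  Blank : Cell m n → Set
  Blank c = label c ≡ nothing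

  Linked : Cell m n → Cell m n → Set
  Linked c d = label c ≡ label d × Separated Blank c d

  LinkSeparated : Cell m n → Cell m n → Set
  LinkSeparated c d = ∃ λ c′ → Linked c c′ × ∃ λ d′ → Linked d d′ × Separated Blank c′ d′

  Determined : Cell m n → Cell m n → Set
  Determined c d = LinkSeparated c d ⊎ LinkSeparated (corner c d) (corner d c)

-- Inductive, so that over ℝ nonnegativity can be proved summand by summand at each index of the
-- Cauchy sequences.
data SumOfSquares {ρ} {A : Set ρ} (_+_ _*_ : Op₂ A) (0# : A) : A → Set ρ where
  empty  : SumOfSquares _+_ _*_ 0# 0#
  [_]²   : ∀ a → SumOfSquares _+_ _*_ 0# (a * a)
  _⊞_    : ∀ {a b} → SumOfSquares _+_ _*_ 0# a → SumOfSquares _+_ _*_ 0# b → SumOfSquares _+_ _*_ 0# (a + b)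

module SumsOfSquares {ρ ℓ} (R : CommutativeRing ρ ℓ) where

  open CommutativeRing R hiding (zero)
  open import Algebra.Properties.Semiring.Sum semiring
  open import Algebra.Properties.Semiring.Mult semiring using (×-homo-+) renaming (_×_ to _•_)
  open import Algebra.Properties.Ring ring using (+-cancelˡ; +-cancelʳ)
  open import Algebra.Solver.Ring.NaturalCoefficients.Default commutativeSemiring
    using (solve; _:+_; _:*_; _:=_; con)
  open import Relation.Binary.Reasoning.Setoid setoid

  private variable
    r s : ℕ

  infixl 6 _⊕_
  _⊕_ : Vector Carrier r → Vector Carrier r → Vector Carrier r
  _⊕_ = zipWith _+_

  infix 7 _·_
  _·_ : Vector Carrier r → Vector Carrier r → Carrier
  u · v = ∑[ p < _ ] (u p * v p)

  ∑-cong : {u v : Vector Carrier r} → (∀ p → u p ≈ v p) → sum u ≈ sum v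
  ∑-cong = sum-cong-≋

  ∑-zero : {u : Vector Carrier r} → (∀ p → u p ≈ 0#) → sum u ≈ 0#
  ∑-zero {r} u≈0 = trans (∑-cong u≈0) (sum-replicate-zero r)

  ·-cong : {u u′ v v′ : Vector Carrier r} → (∀ p → u p ≈ u′ p) → (∀ p → v p ≈ v′ p) → u · v ≈ u′ · v′
  ·-cong u≈u′ v≈v′ = ∑-cong λ p → *-cong (u≈u′ p) (v≈v′ p)

  ·-comm : (u v : Vector Carrier r) → u · v ≈ v · u
  ·-comm u v = ∑-cong λ p → *-comm (u p) (v p)

  ·-distribˡ : (u v w : Vector Carrier r) → u · (v ⊕ w) ≈ u · v + u · w
  ·-distribˡ u v w = trans (∑-cong λ p → distribˡ (u p) (v p) (w p)) (∑-distrib-+ (λ p → u p * v p) (λ p → u p * w p))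

  ·-distribʳ : (u v w : Vector Carrier r) → (v ⊕ w) · u ≈ v · u + w · u
  ·-distribʳ u v w = trans (∑-cong λ p → distribʳ (u p) (v p) (w p)) (∑-distrib-+ (λ p → v p * u p) (λ p → w p * u p))

  ·-zeroˡ : {u : Vector Carrier r} → (∀ p → u p ≈ 0#) → ∀ v → u · v ≈ 0#
  ·-zeroˡ u≈0 v = ∑-zero λ p → trans (*-congʳ (u≈0 p)) (zeroˡ (v p))

  ·-square-⊕ : (u v : Vector Carrier r) → (u ⊕ v) · (u ⊕ v) ≈ (u · u + v · v) + (u · v + u · v)
  ·-square-⊕ u v = begin
    (u ⊕ v) · (u ⊕ v)                      ≈⟨ ·-distribˡ (u ⊕ v) u v ⟩
    (u ⊕ v) · u + (u ⊕ v) · v              ≈⟨ +-cong (·-distribʳ u u v) (·-distribʳ v u v) ⟩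
    (u · u + v · u) + (u · v + v · v)      ≈⟨ +-congʳ (+-congˡ (·-comm v u)) ⟩
    (u · u + u · v) + (u · v + v · v)      ≈⟨ solve 3 (λ a b c → (a :+ b) :+ (b :+ c) := (a :+ c) :+ (b :+ b)) refl (u · u) (u · v) (v · v) ⟩
    (u · u + v · v) + (u · v + u · v)      ∎

  unit : Fin r → Vector Carrier r
  unit zero    zero    = 1#
  unit zero    (suc _) = 0#
  unit (suc _) zero    = 0#
  unit (suc i) (suc j) = unit i j

  unit-diagonal : (i : Fin r) → unit i i ≈ 1#
  unit-diagonal zero    = refl
  unit-diagonal (suc i) = unit-diagonal i

  unit-sym : (i j : Fin r) → unit i j ≈ unit j i
  unit-sym zero    zero    = refl
  unit-sym zero    (suc j) = refl
  unit-sym (suc i) zero    = refl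
  unit-sym (suc i) (suc j) = unit-sym i j

  ·-unit : (u : Vector Carrier r) (i : Fin r) → u · unit i ≈ u i
  ·-unit u zero    = trans (+-cong (*-identityʳ _) (∑-zero λ p → zeroʳ (u (suc p)))) (+-identityʳ _)
  ·-unit u (suc i) = trans (+-cong (zeroʳ _) (·-unit (λ p → u (suc p)) i)) (+-identityˡ _)

  unit-· : (i : Fin r) (u : Vector Carrier r) → unit i · u ≈ u i
  unit-· i u = trans (·-comm (unit i) u) (·-unit u i)

  evalForm : ∀ {m n} → (Fin m → Fin n → Carrier) → Vector Carrier m → Vector Carrier n → Carrier
  evalForm {m} {n} f x y = ∑[ i < m ] ∑[ j < n ] (f i j * x i * y j)

  evalForm-⊕ˡ : ∀ {m n} (f : Fin m → Fin n → Carrier) x x′ y →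
                evalForm f (x ⊕ x′) y ≈ evalForm f x y + evalForm f x′ y
  evalForm-⊕ˡ {m} {n} f x x′ y = trans
    (∑-cong λ i → trans
      (∑-cong λ j → solve 4 (λ a b c d → a :* (b :+ c) :* d := a :* b :* d :+ a :* c :* d) refl (f i j) (x i) (x′ i) (y j))
      (∑-distrib-+ (λ j → f i j * x i * y j) (λ j → f i j * x′ i * y j)))
    (∑-distrib-+ (λ i → ∑[ j < n ] (f i j * x i * y j)) (λ i → ∑[ j < n ] (f i j * x′ i * y j)))

  evalForm-⊕ʳ : ∀ {m n} (f : Fin m → Fin n → Carrier) x y y′ →
                evalForm f x (y ⊕ y′) ≈ evalForm f x y + evalForm f x y′
  evalForm-⊕ʳ {m} {n} f x y y′ = trans
    (∑-cong λ i → trans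
      (∑-cong λ j → distribˡ (f i j * x i) (y j) (y′ j))
      (∑-distrib-+ (λ j → f i j * x i * y j) (λ j → f i j * x i * y′ j)))
    (∑-distrib-+ (λ i → ∑[ j < n ] (f i j * x i * y j)) (λ i → ∑[ j < n ] (f i j * x i * y′ j)))

  evalForm-unit : ∀ {m n} (f : Fin m → Fin n → Carrier) i j → evalForm f (unit i) (unit j) ≈ f i j
  evalForm-unit f i j = begin
    evalForm f (unit i) (unit j)             ≈⟨ ∑-cong (λ k → ·-unit (λ l → f k l * unit i k) j) ⟩
    (λ k → f k j) · unit i                   ≈⟨ ·-unit (λ k → f k j) i ⟩
    f i j                                    ∎

  Forms : ℕ → ℕ → ℕ → Set ρ
  Forms r m n = Fin r → Fin m → Fin n → Carrier

  values : ∀ {m n} → Forms r m n → Vector Carrier m → Vector Carrier n → Vector Carrier r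
  values f x y p = evalForm (f p) x y

  coefficients : ∀ {m n} → Forms r m n → Cell m n → Vector Carrier r
  coefficients f c p = f p (row c) (col c)

  gram : ∀ {m n} → Forms r m n → Cell m n → Cell m n → Carrier
  gram f c d = coefficients f c · coefficients f d

  -- The coefficient of x_i x_k y_j y_l in the sum of the squares of the
  -- forms f, shared evenly by its index permutations.
  squareCoefficient : Carrier → ∀ {m n} → Forms r m n → Fin m → Fin n → Fin m → Fin n → Carrier
  squareCoefficient half f i j k l = half * (gram f (i , j) (k , l) + gram f (k , j) (i , l))

  squareCoefficient-sym₁ : ∀ half {m n} (f : Forms r m n) i j k l →
    squareCoefficient half f i j k l ≈ squareCoefficient half f k j i l
  squareCoefficient-sym₁ half f i j k l = *-congˡ (+-comm _ _)

  squareCoefficient-sym₂ : ∀ half {m n} (f : Forms r m n) i j k l →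
    squareCoefficient half f i j k l ≈ squareCoefficient half f k l i j
  squareCoefficient-sym₂ half f i j k l = *-congˡ (+-cong
    (·-comm (coefficients f (i , j)) (coefficients f (k , l)))
    (·-comm (coefficients f (k , j)) (coefficients f (i , l))))

  module _ (half : Carrier) (half+half : half + half ≈ 1#) where

    half-double : ∀ a → half * (a + a) ≈ a
    half-double a = begin
      half * (a + a)        ≈⟨ solve 2 (λ h a → h :* (a :+ a) := (h :+ h) :* a) refl half a ⟩
      (half + half) * a     ≈⟨ *-congʳ half+half ⟩
      1# * a                ≈⟨ *-identityˡ a ⟩
      a                     ∎

    double-injective : ∀ {a b} → a + a ≈ b + b → a ≈ b
    double-injective {a} {b} eq = begin
      a                  ≈⟨ half-double a ⟨
      half * (a + a)     ≈⟨ *-congˡ eq ⟩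
      half * (b + b)     ≈⟨ half-double b ⟩
      b                  ∎

    -- The sums of `T i k` and of `T k i` over all `i` and `k` agree by exchanging the summations,
    -- so `half` cancels the symmetrisation. `square` then moves the sum over the forms outermost
    -- and factors each summand.
    eval-squareCoefficient : ∀ {m n} (f : Forms r m n) x y →
      ∑[ i < m ] ∑[ k < m ] ∑[ j < n ] ∑[ l < n ] (squareCoefficient half f i j k l * x i * x k * y j * y l)
        ≈ values f x y · values f x y
    eval-squareCoefficient {r} {m} {n} f x y = begin
      (∑[ i < m ] ∑[ k < m ] ∑[ j < n ] ∑[ l < n ] (squareCoefficient half f i j k l * x i * x k * y j * y l))
        ≈⟨ ∑-cong (λ i → ∑-cong λ k → split i k) ⟩
      (∑[ i < m ] ∑[ k < m ] (half * (T i k + T k i)))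
        ≈⟨ ∑-cong (λ i → *-distribˡ-sum half (λ k → T i k + T k i)) ⟨
      (∑[ i < m ] (half * ∑[ k < m ] (T i k + T k i)))
        ≈⟨ *-distribˡ-sum half (λ i → ∑[ k < m ] (T i k + T k i)) ⟨
      half * (∑[ i < m ] ∑[ k < m ] (T i k + T k i))
        ≈⟨ *-congˡ (∑-cong λ i → ∑-distrib-+ (T i) (λ k → T k i)) ⟩
      half * (∑[ i < m ] (sum (T i) + ∑[ k < m ] T k i))
        ≈⟨ *-congˡ (∑-distrib-+ (λ i → sum (T i)) (λ i → ∑[ k < m ] T k i)) ⟩
      half * (∑T + ∑[ i < m ] ∑[ k < m ] T k i)
        ≈⟨ *-congˡ (+-congˡ (∑-comm (λ i k → T k i))) ⟩
      half * (∑T + ∑T)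
        ≈⟨ half-double ∑T ⟩
      ∑T
        ≈⟨ square ⟩
      values f x y · values f x y ∎
      where
      term : Fin m → Fin n → Fin m → Fin n → Carrier
      term i j k l = gram f (i , j) (k , l) * (x i * y j * (x k * y l))

      T : Fin m → Fin m → Carrier
      T i k = ∑[ j < n ] ∑[ l < n ] term i j k l

      ∑T : Carrier
      ∑T = ∑[ i < m ] ∑[ k < m ] T i k

      split : ∀ i k → ∑[ j < n ] ∑[ l < n ] (squareCoefficient half f i j k l * x i * x k * y j * y l)
                        ≈ half * (T i k + T k i)
      split i k = begin
        ∑[ j < n ] ∑[ l < n ] (squareCoefficient half f i j k l * x i * x k * y j * y l)
          ≈⟨ ∑-cong (λ j → ∑-cong λ l →
               solve 7 (λ h a b xi xk yj yl → h :* (a :+ b) :* xi :* xk :* yj :* yl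
                 := h :* (a :* (xi :* yj :* (xk :* yl)) :+ b :* (xk :* yj :* (xi :* yl)))) refl
               half (gram f (i , j) (k , l)) (gram f (k , j) (i , l)) (x i) (x k) (y j) (y l)) ⟩
        (∑[ j < n ] ∑[ l < n ] (half * (term i j k l + term k j i l)))
          ≈⟨ ∑-cong (λ j → *-distribˡ-sum half (λ l → term i j k l + term k j i l)) ⟨
        (∑[ j < n ] (half * ∑[ l < n ] (term i j k l + term k j i l)))
          ≈⟨ *-distribˡ-sum half (λ j → ∑[ l < n ] (term i j k l + term k j i l)) ⟨
        half * (∑[ j < n ] ∑[ l < n ] (term i j k l + term k j i l))
          ≈⟨ *-congˡ (∑-cong λ j → ∑-distrib-+ (term i j k) (term k j i)) ⟩
        half * (∑[ j < n ] (sum (term i j k) + sum (term k j i)))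
          ≈⟨ *-congˡ (∑-distrib-+ (λ j → sum (term i j k)) (λ j → sum (term k j i))) ⟩
        half * (T i k + T k i) ∎

      square : ∑T ≈ values f x y · values f x y
      square = begin
        (∑[ i < m ] ∑[ k < m ] ∑[ j < n ] ∑[ l < n ] term i j k l)
          ≈⟨ ∑-cong (λ i → ∑-comm (λ k j → ∑[ l < n ] term i j k l)) ⟩
        (∑[ i < m ] ∑[ j < n ] ∑[ k < m ] ∑[ l < n ] term i j k l)
          ≈⟨ ∑-cong (λ i → ∑-cong λ j → ∑-cong λ k → ∑-cong λ l → trans
               (*-distribʳ-sum (x i * y j * (x k * y l)) (λ p → f p i j * f p k l))
               (∑-cong λ p → solve 6 (λ a b xi xk yj yl → a :* b :* (xi :* yj :* (xk :* yl))
                  := (a :* xi :* yj) :* (b :* xk :* yl)) refl (f p i j) (f p k l) (x i) (x k) (y j) (y l))) ⟩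
        (∑[ i < m ] ∑[ j < n ] ∑[ k < m ] ∑[ l < n ] ∑[ p < r ] (v p i j * v p k l))
          ≈⟨ ∑-cong (λ i → ∑-cong λ j → trans (∑-cong λ k → ∑-comm (λ l p → v p i j * v p k l))
                                               (∑-comm (λ k p → ∑[ l < n ] (v p i j * v p k l)))) ⟩
        (∑[ i < m ] ∑[ j < n ] ∑[ p < r ] ∑[ k < m ] ∑[ l < n ] (v p i j * v p k l))
          ≈⟨ ∑-cong (λ i → ∑-cong λ j → ∑-cong λ p → trans (*-distribˡ-sum (v p i j) (λ k → sum (v p k)))
                                                (∑-cong λ k → *-distribˡ-sum (v p i j) (v p k))) ⟨
        (∑[ i < m ] ∑[ j < n ] ∑[ p < r ] (v p i j * values f x y p))
          ≈⟨ trans (∑-cong λ i → ∑-comm (λ j p → v p i j * values f x y p))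
                   (∑-comm (λ i p → ∑[ j < n ] (v p i j * values f x y p))) ⟩
        (∑[ p < r ] ∑[ i < m ] ∑[ j < n ] (v p i j * values f x y p))
          ≈⟨ ∑-cong (λ p → trans (*-distribʳ-sum (values f x y p) (λ i → sum (v p i)))
                                  (∑-cong λ i → *-distribʳ-sum (values f x y p) (v p i))) ⟨
        values f x y · values f x y ∎
        where
        v : Fin r → Fin m → Fin n → Carrier
        v p i j = f p i j * x i * y j

    -- Comparing the coefficients of two sums of squares

    module Polarisation {m n} (f : Forms r m n) (g : Forms s m n)
      (same : ∀ x y → values f x y · values f x y ≈ values g x y · values g x y) where

      -- By `·-square-⊕` the cross term is twice the product, and the factor 2 cancels.
      polarise : (u v : Vector Carrier r) (u′ v′ : Vector Carrier s) →
                 u · u ≈ u′ · u′ → v · v ≈ v′ · v′ → (u ⊕ v) · (u ⊕ v) ≈ (u′ ⊕ v′) · (u′ ⊕ v′) → u · v ≈ u′ · v′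
      polarise u v u′ v′ uu vv u+v = double-injective (+-cancelˡ (u · u + v · v) _ _ (begin
        (u · u + v · v) + (u · v + u · v)             ≈⟨ ·-square-⊕ u v ⟨
        (u ⊕ v) · (u ⊕ v)                             ≈⟨ u+v ⟩
        (u′ ⊕ v′) · (u′ ⊕ v′)                         ≈⟨ ·-square-⊕ u′ v′ ⟩
        (u′ · u′ + v′ · v′) + (u′ · v′ + u′ · v′)     ≈⟨ +-congʳ (+-cong uu vv) ⟨
        (u · u + v · v) + (u′ · v′ + u′ · v′)         ∎))

      values-⊕ʳ : ∀ {r} (f : Forms r m n) x y y′ → values f x (y ⊕ y′) · values f x (y ⊕ y′)
                    ≈ (values f x y ⊕ values f x y′) · (values f x y ⊕ values f x y′)
      values-⊕ʳ f x y y′ = ·-cong (λ p → evalForm-⊕ʳ (f p) x y y′) (λ p → evalForm-⊕ʳ (f p) x y y′)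

      same-y : ∀ x y y′ → values f x y · values f x y′ ≈ values g x y · values g x y′
      same-y x y y′ = polarise _ _ _ _ (same x y) (same x y′)
        (trans (sym (values-⊕ʳ f x y y′)) (trans (same x (y ⊕ y′)) (values-⊕ʳ g x y y′)))

      expand-x : ∀ {r} (f : Forms r m n) x x′ y y′ →
        values f (x ⊕ x′) y · values f (x ⊕ x′) y′
          ≈ (values f x y · values f x y′ + values f x′ y · values f x′ y′)
            + (values f x y · values f x′ y′ + values f x y′ · values f x′ y)
      expand-x f x x′ y y′ = begin
        values f (x ⊕ x′) y · values f (x ⊕ x′) y′
          ≈⟨ ·-cong (λ p → evalForm-⊕ˡ (f p) x x′ y) (λ p → evalForm-⊕ˡ (f p) x x′ y′) ⟩
        (a ⊕ b) · (c ⊕ d)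
          ≈⟨ trans (·-distribˡ (a ⊕ b) c d) (+-cong (·-distribʳ c a b) (·-distribʳ d a b)) ⟩
        (a · c + b · c) + (a · d + b · d)
          ≈⟨ +-congʳ (+-congˡ (·-comm b c)) ⟩
        (a · c + c · b) + (a · d + b · d)
          ≈⟨ solve 4 (λ p q r s → (p :+ q) :+ (r :+ s) := (p :+ s) :+ (r :+ q)) refl (a · c) (c · b) (a · d) (b · d) ⟩
        (a · c + b · d) + (a · d + c · b) ∎
        where
        a = values f x y
        b = values f x′ y
        c = values f x y′
        d = values f x′ y′

      -- Polarises `same-y` in the first variable. The mixed terms stay together: a product of
      -- values is determined only jointly with the one in which `y` and `y′` are exchanged.
      same-xy : ∀ x x′ y y′ →
        values f x y · values f x′ y′ + values f x y′ · values f x′ y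
          ≈ values g x y · values g x′ y′ + values g x y′ · values g x′ y
      same-xy x x′ y y′ = +-cancelˡ (values f x y · values f x y′ + values f x′ y · values f x′ y′) _ _ (begin
        _ ≈⟨ expand-x f x x′ y y′ ⟨
        _ ≈⟨ same-y (x ⊕ x′) y y′ ⟩
        _ ≈⟨ expand-x g x x′ y y′ ⟩
        _ ≈⟨ +-congʳ (+-cong (same-y x y y′) (same-y x′ y y′)) ⟨
        _ ∎)

      -- Unit vectors pick out coefficients. For each rectangle of cells, the form fixes the sum of
      -- the products along the two diagonals.
      gram-corner : ∀ c d → gram f c d + gram f (corner c d) (corner d c)
                              ≈ gram g c d + gram g (corner c d) (corner d c)
      gram-corner (i , j) (k , l) = trans (sym (at-units f)) (trans (same-xy (unit i) (unit k) (unit j) (unit l)) (at-units g))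
        where
        at-units : ∀ {r} (f : Forms r m n) →
          values f (unit i) (unit j) · values f (unit k) (unit l) + values f (unit i) (unit l) · values f (unit k) (unit j)
            ≈ gram f (i , j) (k , l) + gram f (i , l) (k , j)
        at-units f = +-cong (·-cong (λ p → evalForm-unit (f p) i j) (λ p → evalForm-unit (f p) k l))
                            (·-cong (λ p → evalForm-unit (f p) i l) (λ p → evalForm-unit (f p) k j))

  SquareSum : Carrier → Set ρ
  SquareSum = SumOfSquares _+_ _*_ 0#

  ∑-squareSum : (u : Vector Carrier r) → (∀ p → SquareSum (u p)) → SquareSum (sum u)
  ∑-squareSum {zero}  u uSq = empty
  ∑-squareSum {suc r} u uSq = uSq zero ⊞ ∑-squareSum (λ p → u (suc p)) (λ p → uSq (suc p))

  ·-squareSum : (u : Vector Carrier r) → SquareSum (u · u)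
  ·-squareSum u = ∑-squareSum _ λ p → [ u p ]²

  indicator : Maybe (Fin r) → Vector Carrier r
  indicator = maybe′ unit λ _ → 0#

  labelForms : ∀ {m n N} → (Cell m n → Maybe (Fin N)) → Forms N m n
  labelForms label q i j = indicator (label (i , j)) q

  -- Bounding the number of squares over a formally real ring

  module FormallyReal
    (half : Carrier) (half+half : half + half ≈ 1#) (1≉0 : ¬ 1# ≈ 0#)
    (real : ∀ x {s} → SquareSum s → x * x + s ≈ 0# → x ≈ 0#) where

    -- The later coordinates contribute a sum of squares, so `real` annihilates the first one; the
    -- tail then has square 0 as well.
    ·-definite : (u : Vector Carrier r) → u · u ≈ 0# → ∀ p → u p ≈ 0#
    ·-definite {suc r} u u·u≈0 zero    = real (u zero) (·-squareSum λ p → u (suc p)) u·u≈0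
    ·-definite {suc r} u u·u≈0 (suc p) = ·-definite u₊ (begin
        u₊ · u₊                        ≈⟨ +-identityˡ _ ⟨
        0# + u₊ · u₊                   ≈⟨ +-congʳ (trans (*-congʳ (·-definite u u·u≈0 zero)) (zeroˡ _)) ⟨
        u zero * u zero + u₊ · u₊      ≈⟨ u·u≈0 ⟩
        0#                             ∎) p
      where
      u₊ : Vector Carrier r
      u₊ p = u (suc p)

    -- Squaring u = (u - v) + v and expanding u · v along it leaves
    -- (u - v) · (u - v) = 0.
    ·-equal : (u v : Vector Carrier r) → u · u + v · v ≈ u · v + u · v → ∀ p → u p ≈ v p
    ·-equal {r} u v eq p = trans (sym (w⊕v≈u p)) (trans (+-congʳ (·-definite w w·w≈0 p)) (+-identityˡ (v p)))
      where
      w : Vector Carrier r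
      w p = u p - v p
      w⊕v≈u : ∀ p → (w ⊕ v) p ≈ u p
      w⊕v≈u p = trans (+-assoc _ _ _) (trans (+-congˡ (-‿inverseˡ (v p))) (+-identityʳ (u p)))
      w·w≈0 : w · w ≈ 0#
      w·w≈0 = +-cancelʳ ((w · v + v · v) + (w · v + v · v)) _ _ (begin
        w · w + ((w · v + v · v) + (w · v + v · v))
          ≈⟨ solve 3 (λ a b c → a :+ ((b :+ c) :+ (b :+ c)) := ((a :+ c) :+ (b :+ b)) :+ c) refl (w · w) (w · v) (v · v) ⟩
        ((w · w + v · v) + (w · v + w · v)) + v · v
          ≈⟨ +-congʳ (trans (sym (·-square-⊕ w v)) (·-cong w⊕v≈u w⊕v≈u)) ⟩
        u · u + v · v
          ≈⟨ eq ⟩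
        u · v + u · v
          ≈⟨ +-cong u·v u·v ⟩
        (w · v + v · v) + (w · v + v · v)
          ≈⟨ +-identityˡ _ ⟨
        0# + ((w · v + v · v) + (w · v + v · v)) ∎)
        where
        u·v : u · v ≈ w · v + v · v
        u·v = trans (·-cong (λ p → sym (w⊕v≈u p)) (λ _ → refl)) (·-distribʳ v w v)

    -- For M = VᵀV with V the matrix of rows v a, the matrix 1 - M is a
    -- symmetric idempotent, and the sum of the squares of its entries is its
    -- trace r - N.
    orthonormal⇒≤ : ∀ {N} (v : Fin N → Vector Carrier r) → (∀ a b → v a · v b ≈ unit a b) → N ℕ.≤ r
    orthonormal⇒≤ {r} {N} v orthonormal = ℕ.≮⇒≥ λ r<N → impossible (ℕ.m≤n⇒∃[o]m+o≡n r<N)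
      where
      M w : Fin r → Vector Carrier r
      M p q = ∑[ a < N ] (v a p * v a q)
      w p q = unit p q - M p q

      w⊕M≈unit : ∀ p q → (w p ⊕ M p) q ≈ unit p q
      w⊕M≈unit p q = trans (+-assoc _ _ _) (trans (+-congˡ (-‿inverseˡ (M p q))) (+-identityʳ (unit p q)))

      -- `M` is the projection onto the span of the orthonormal vectors, so it fixes each of them.
      v·M : ∀ p a → v a · M p ≈ v a p
      v·M p a = begin
        (∑[ q < r ] (v a q * ∑[ b < N ] (v b p * v b q)))     ≈⟨ ∑-cong (λ q → *-distribˡ-sum (v a q) (λ b → v b p * v b q)) ⟩
        (∑[ q < r ] ∑[ b < N ] (v a q * (v b p * v b q)))     ≈⟨ ∑-comm (λ q b → v a q * (v b p * v b q)) ⟩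
        (∑[ b < N ] ∑[ q < r ] (v a q * (v b p * v b q)))     ≈⟨ ∑-cong (λ b → ∑-cong λ q → solve 3 (λ x y z → x :* (y :* z) := y :* (x :* z)) refl (v a q) (v b p) (v b q)) ⟩
        (∑[ b < N ] ∑[ q < r ] (v b p * (v a q * v b q)))     ≈⟨ ∑-cong (λ b → *-distribˡ-sum (v b p) (λ q → v a q * v b q)) ⟨
        (∑[ b < N ] (v b p * (v a · v b)))                    ≈⟨ ∑-cong (λ b → *-congˡ (trans (orthonormal a b) (unit-sym a b))) ⟩
        (∑[ b < N ] (v b p * unit b a))                       ≈⟨ ∑-cong (λ b → *-congˡ (unit-sym b a)) ⟩
        (∑[ b < N ] (v b p * unit a b))                       ≈⟨ ·-unit (λ b → v b p) a ⟩
        v a p                                                 ∎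

      M·M : ∀ p → M p · M p ≈ M p p
      M·M p = begin
        (∑[ q < r ] ((∑[ a < N ] (v a p * v a q)) * M p q))   ≈⟨ ∑-cong (λ q → *-distribʳ-sum (M p q) (λ a → v a p * v a q)) ⟩
        (∑[ q < r ] ∑[ a < N ] (v a p * v a q * M p q))       ≈⟨ ∑-comm (λ q a → v a p * v a q * M p q) ⟩
        (∑[ a < N ] ∑[ q < r ] (v a p * v a q * M p q))       ≈⟨ ∑-cong (λ a → ∑-cong λ q → *-assoc (v a p) (v a q) (M p q)) ⟩
        (∑[ a < N ] ∑[ q < r ] (v a p * (v a q * M p q)))     ≈⟨ ∑-cong (λ a → *-distribˡ-sum (v a p) (λ q → v a q * M p q)) ⟨
        (∑[ a < N ] (v a p * (v a · M p)))                    ≈⟨ ∑-cong (λ a → *-congˡ (v·M p a)) ⟩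
        M p p                                                 ∎

      w·M : ∀ p → w p · M p ≈ 0#
      w·M p = +-cancelʳ (M p · M p) _ _ (begin
        w p · M p + M p · M p     ≈⟨ ·-distribʳ (M p) (w p) (M p) ⟨
        (w p ⊕ M p) · M p         ≈⟨ ·-cong (w⊕M≈unit p) (λ _ → refl) ⟩
        unit p · M p              ≈⟨ unit-· p (M p) ⟩
        M p p                     ≈⟨ M·M p ⟨
        M p · M p                 ≈⟨ +-identityˡ _ ⟨
        0# + M p · M p            ∎)

      w·w : ∀ p → w p · w p + M p p ≈ 1#
      w·w p = begin
        w p · w p + M p p                                               ≈⟨ +-congˡ (M·M p) ⟨
        w p · w p + M p · M p                                           ≈⟨ +-identityʳ _ ⟨
        (w p · w p + M p · M p) + 0#                                    ≈⟨ +-congˡ (trans (+-cong (w·M p) (w·M p)) (+-identityʳ 0#)) ⟨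
        (w p · w p + M p · M p) + (w p · M p + w p · M p)               ≈⟨ ·-square-⊕ (w p) (M p) ⟨
        (w p ⊕ M p) · (w p ⊕ M p)                                       ≈⟨ ·-cong (w⊕M≈unit p) (w⊕M≈unit p) ⟩
        unit p · unit p                                                 ≈⟨ unit-· p (unit p) ⟩
        unit p p                                                        ≈⟨ unit-diagonal p ⟩
        1#                                                              ∎

      -- Sums `w·w` over `p`. Exchanging summations turns the trace of `M` into the sum of the
      -- `v a · v a`, each of which is 1.
      trace : ∑[ p < r ] (w p · w p) + N • 1# ≈ r • 1#
      trace = begin
        ∑[ p < r ] (w p · w p) + N • 1#                           ≈⟨ +-congˡ (sum-replicate N) ⟨
        ∑[ p < r ] (w p · w p) + ∑[ a < N ] 1#                    ≈⟨ +-congˡ (∑-cong λ a → trans (orthonormal a a) (unit-diagonal a)) ⟨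
        ∑[ p < r ] (w p · w p) + ∑[ a < N ] (v a · v a)           ≈⟨ +-congˡ (∑-comm (λ a p → v a p * v a p)) ⟩
        ∑[ p < r ] (w p · w p) + ∑[ p < r ] M p p                 ≈⟨ ∑-distrib-+ (λ p → w p · w p) (λ p → M p p) ⟨
        (∑[ p < r ] (w p · w p + M p p))                          ≈⟨ ∑-cong w·w ⟩
        (∑[ p < r ] 1#)                                           ≈⟨ sum-replicate r ⟩
        r • 1#                                                    ∎

      impossible : ¬ (∃ λ k → suc r ℕ.+ k ≡ N)
      -- With `N = r + 1 + k` the trace identity reads `1 + k + W = 0`. The left side is a sum of
      -- squares containing the square of 1, so `real` would give `1# ≈ 0#`.
      impossible (k , ≡.refl) = 1≉0 (real 1#
        (∑-squareSum (λ (_ : Fin k) → 1# * 1#) (λ _ → [ 1# ]²) ⊞ ∑-squareSum _ λ p → ·-squareSum (w p))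
        (+-cancelʳ (r • 1#) _ _ (begin
          (1# * 1# + (∑[ j < k ] (1# * 1#) + W)) + r • 1#
            ≈⟨ +-congʳ (+-cong (*-identityˡ 1#) (+-congʳ (trans (∑-cong {k} λ _ → *-identityˡ 1#) (sum-replicate k)))) ⟩
          (1# + (k • 1# + W)) + r • 1#
            ≈⟨ solve 4 (λ o κ W ρ → (o :+ (κ :+ W)) :+ ρ := W :+ (o :+ (ρ :+ κ))) refl 1# (k • 1#) W (r • 1#) ⟩
          W + (1# + (r • 1# + k • 1#))
            ≈⟨ +-congˡ (+-congˡ (×-homo-+ 1# r k)) ⟨
          W + (suc r ℕ.+ k) • 1#
            ≈⟨ trace ⟩
          r • 1#
            ≈⟨ +-identityˡ _ ⟨
          0# + r • 1# ∎)))
        where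
        W : Carrier
        W = ∑[ p < r ] (w p · w p)

    module _ {m n N} (label : Cell m n → Maybe (Fin N)) (f : Forms r m n)
      (same : ∀ x y → values f x y · values f x y ≈ values (labelForms label) x y · values (labelForms label) x y) where

      open Labelling label
      open Polarisation half half+half f (labelForms label) same

      Agree : Cell m n → Cell m n → Set ℓ
      Agree c d = gram f c d ≈ gram (labelForms label) c d

      -- `gram-corner` fixes the sum over both diagonals, so agreement on one diagonal passes to the
      -- other.
      corner-agree : ∀ c d → Agree (corner c d) (corner d c) → Agree c d
      corner-agree c d eq = +-cancelʳ (gram f (corner c d) (corner d c)) _ _
        (trans (gram-corner c d) (+-congˡ (sym eq)))

      -- In a rectangle with one row the two diagonals are the same pair up to order, so
      -- `gram-corner` compares twice the product.
      row-agree : ∀ c d → row c ≡ row d → Agree c d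
      row-agree (i , j) (.i , l) ≡.refl = double-injective half half+half (begin
        gram f (i , j) (i , l) + gram f (i , j) (i , l)     ≈⟨ +-congˡ (·-comm (coefficients f (i , j)) (coefficients f (i , l))) ⟩
        gram f (i , j) (i , l) + gram f (i , l) (i , j)     ≈⟨ gram-corner (i , j) (i , l) ⟩
        gram g (i , j) (i , l) + gram g (i , l) (i , j)     ≈⟨ +-congˡ (·-comm (coefficients g (i , l)) (coefficients g (i , j))) ⟩
        gram g (i , j) (i , l) + gram g (i , j) (i , l)     ∎)
        where
        g = labelForms label

      col-agree : ∀ c d → col c ≡ col d → Agree c d
      col-agree c@(i , j) d@(k , .j) ≡.refl = double-injective half half+half (gram-corner c d)

      -- The labelled forms vanish at a blank cell, so by `row-agree` the vector of `f` there has
      -- square 0, and it vanishes too.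
      blank-agree : ∀ c d → Blank c → Agree c d
      blank-agree c d blank = trans
        (·-zeroˡ (·-definite (coefficients f c) (trans (row-agree c c ≡.refl) (gram-zero c))) (coefficients f d))
        (sym (gram-zero d))
        where
        gram-zero : ∀ d → gram (labelForms label) c d ≈ 0#
        gram-zero d = ·-zeroˡ (λ p → reflexive (≡.cong (λ a → indicator a p) blank)) (coefficients (labelForms label) d)

      agree-sym : ∀ c d → Agree c d → Agree d c
      agree-sym c d eq = trans (·-comm (coefficients f d) (coefficients f c))
        (trans eq (·-comm (coefficients (labelForms label) c) (coefficients (labelForms label) d)))

      separated-agree : ∀ c d → Separated Blank c d → Agree c d
      separated-agree c d (inj₁ eq)                    = row-agree c d eq
      separated-agree c d (inj₂ (inj₁ eq))             = col-agree c d eq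
      separated-agree c d (inj₂ (inj₂ (inj₁ blank)))   = corner-agree c d (blank-agree (corner c d) (corner d c) blank)
      separated-agree c d (inj₂ (inj₂ (inj₂ blank)))   =
        corner-agree c d (agree-sym (corner d c) (corner c d) (blank-agree (corner d c) (corner c d) blank))

      gram-label : ∀ {c c′ d d′} → label c ≡ label c′ → label d ≡ label d′ →
                   gram (labelForms label) c d ≡ gram (labelForms label) c′ d′
      gram-label eq eq′ = ≡.cong₂ (λ a b → indicator a · indicator b) eq eq′

      -- Cells with one label have the same vector in the labelled forms. Hence the two squares and
      -- the product of the vectors of `f` all agree, and `·-equal` applies.
      linked-equal : ∀ c c′ → Linked c c′ → ∀ p → coefficients f c p ≈ coefficients f c′ p
      linked-equal c c′ (eq , sep) = ·-equal (coefficients f c) (coefficients f c′) (trans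
        (+-cong (trans (row-agree c c ≡.refl) (reflexive (gram-label {c} {c} ≡.refl eq)))
                (trans (row-agree c′ c′ ≡.refl) (reflexive (gram-label {c′} {c} {c′} {c′} (≡.sym eq) ≡.refl))))
        (sym (+-cong (separated-agree c c′ sep) (separated-agree c c′ sep))))

      linkSeparated-agree : ∀ c d → LinkSeparated c d → Agree c d
      linkSeparated-agree c d (c′ , cc′ , d′ , dd′ , sep) = trans
        (·-cong (linked-equal c c′ cc′) (linked-equal d d′ dd′))
        (trans (separated-agree c′ d′ sep)
               (reflexive (gram-label {c′} {c} {d′} {d} (≡.sym (proj₁ cc′)) (≡.sym (proj₁ dd′)))))

      determined-agree : ∀ c d → Determined c d → Agree c d
      determined-agree c d (inj₁ linked) = linkSeparated-agree c d linked
      determined-agree c d (inj₂ linked) = corner-agree c d (linkSeparated-agree (corner c d) (corner d c) linked)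

      -- At the representatives the labelled forms have the unit vectors as coefficient vectors, so
      -- agreement makes the vectors of `f` orthonormal.
      determined⇒≤ : (rep : Fin N → Cell m n) → (∀ a → label (rep a) ≡ just a) →
                     (∀ a b → Determined (rep a) (rep b)) → N ℕ.≤ r
      determined⇒≤ rep label-rep determined = orthonormal⇒≤ (λ a → coefficients f (rep a)) λ a b → begin
        gram f (rep a) (rep b)                      ≈⟨ determined-agree (rep a) (rep b) (determined a b) ⟩
        gram (labelForms label) (rep a) (rep b)     ≡⟨ ≡.cong₂ (λ x y → indicator x · indicator y) (label-rep a) (label-rep b) ⟩
        unit a · unit b                             ≈⟨ ·-unit (unit a) b ⟩
        unit a b                                    ∎

-- Unfolding arithmetic on the reals makes conversion checking infeasible, so
-- their operations, sums and values of forms are kept as variables here, and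
-- every unfolding is a propositional equation.  For the same reason ranks
-- speaks of any b and e equal to the coefficients and values of a form.
module Abstracted {ρ ℓ} {A : Set ρ} {≈ : Rel A ℓ} {+ * : Op₂ A} { - : Op₁ A} {0# 1# : A}
  (isCommutativeRing : IsCommutativeRing ≈ + * - 0# 1#)
  (∑ : ∀ {n} → Vector A n → A)
  (∑-def : ∀ {n} (u : Vector A n) → ∑ u ≡ foldr + 0# u)
  (eval : ∀ {m n} → (Fin m → Fin n → A) → Vector A m → Vector A n → A)
  (eval-def : ∀ {m n} (f : Fin m → Fin n → A) x y → eval f x y ≡ ∑ λ i → ∑ λ j → * (* (f i j) (x i)) (y j))
  (half : A) (half+half : ≈ (+ half half) 1#) (1≉0 : ¬ ≈ 1# 0#)
  (real : ∀ x {s} → SumOfSquares + * 0# s → ≈ (+ (* x x) s) 0# → ≈ x 0#)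
  where

  private
    R : CommutativeRing ρ ℓ
    R = record { isCommutativeRing = isCommutativeRing }

    module S = SumsOfSquares R

  open CommutativeRing R using (sym; trans; reflexive; *-cong; *-congʳ; setoid)
  open import Relation.Binary.Reasoning.Setoid setoid

  ∑≈ : ∀ {n} {u v : Vector A n} → (∀ i → ≈ (u i) (v i)) → ≈ (∑ u) (foldr + 0# v)
  ∑≈ {u = u} u≈v = trans (reflexive (∑-def u)) (S.∑-cong u≈v)

  private
    squares : ∀ {m n r} → S.Forms r m n → Vector A m → Vector A n → A
    squares f x y = ∑ λ p → * (eval (f p) x y) (eval (f p) x y)

    squares≈ : ∀ {m n r} (f : S.Forms r m n) x y → ≈ (squares f x y) (S._·_ (S.values f x y) (S.values f x y))
    squares≈ f x y = ∑≈ λ p → *-cong (eval≈ (f p)) (eval≈ (f p))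
      where
      eval≈ : ∀ g → ≈ (eval g x y) (S.evalForm g x y)
      eval≈ g = trans (reflexive (eval-def g x y)) (∑≈ λ i → ∑≈ λ j → CommutativeRing.refl R)

  module _ {m n N} (label : Cell m n → Maybe (Fin N)) where

    record LabelCoefficients : Set (ρ ⊔ ℓ) where
      field
        coeff : Fin m → Fin n → Fin m → Fin n → A
        sym₁  : ∀ i j k l → ≈ (coeff i j k l) (coeff k j i l)
        sym₂  : ∀ i j k l → ≈ (coeff i j k l) (coeff k l i j)
        ranks : ∀ (b : Fin m → Fin n → Fin m → Fin n → A) → (∀ i j k l → b i j k l ≡ coeff i j k l) →
          ∀ (e : Vector A m → Vector A n → A) →
          (∀ x y → e x y ≡ ∑ λ i → ∑ λ k → ∑ λ j → ∑ λ l → * (* (* (* (b i j k l) (x i)) (x k)) (y j)) (y l)) →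
          (∃ λ (g : Fin N → Fin m → Fin n → A) →
            (∀ x y → ≈ (e x y) (∑ λ q → * (eval (g q) x y) (eval (g q) x y)))) ×
          ((rep : Fin N → Cell m n) → (∀ a → label (rep a) ≡ just a) →
           (∀ a b → Labelling.Determined label (rep a) (rep b)) →
           ∀ r (f : Fin r → Fin m → Fin n → A) →
           (∀ x y → ≈ (e x y) (∑ λ p → * (eval (f p) x y) (eval (f p) x y))) → N ℕ.≤ r)

    labelCoefficients : LabelCoefficients
    labelCoefficients = record
      { coeff = S.squareCoefficient half g
      ; sym₁  = S.squareCoefficient-sym₁ half g
      ; sym₂  = S.squareCoefficient-sym₂ half g
      ; ranks = λ b b≡ e e≡ → let e≈ = eval-label b b≡ e e≡ in
          (g , e≈) , λ rep label-rep determined r f e≈f² →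
            S.FormallyReal.determined⇒≤ half half+half 1≉0 real label f
              (λ x y → trans (sym (squares≈ f x y)) (trans (sym (e≈f² x y)) (trans (e≈ x y) (squares≈ g x y))))
              rep label-rep determined
      }
      where
      g : S.Forms N m n
      g = S.labelForms label
      eval-label : ∀ b → (∀ i j k l → b i j k l ≡ S.squareCoefficient half g i j k l) → ∀ e →
        (∀ x y → e x y ≡ ∑ λ i → ∑ λ k → ∑ λ j → ∑ λ l → * (* (* (* (b i j k l) (x i)) (x k)) (y j)) (y l)) →
        ∀ x y → ≈ (e x y) (squares g x y)
      eval-label b b≡ e e≡ x y = begin
        e x y           ≡⟨ e≡ x y ⟩
        _               ≈⟨ (∑≈ λ i → ∑≈ λ k → ∑≈ λ j → ∑≈ λ l →
                              *-congʳ (*-congʳ (*-congʳ (*-congʳ (reflexive (b≡ i j k l)))))) ⟩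
        _               ≈⟨ S.eval-squareCoefficient half half+half g x y ⟩
        _               ≈⟨ squares≈ g x y ⟨
        squares g x y   ∎

-- Formal reality of ℝ, and real forms of prescribed SOS rank

module RealForms where

  open Defs using (_+_; _*_; _≈_; sum)

  ½ℝ+½ℝ≈1 : fromℚ ½ + fromℚ ½ ≈ 1ℝ
  ½ℝ+½ℝ≈1 = pointwise (fromℚ ½ + fromℚ ½) 1ℝ λ _ → ≡.refl

  1≉0 : ¬ 1ℝ ≈ 0ℝ
  1≉0 1≈0 = let N , h = 1≈0 .seq-∼ .close 1ℚ (ℚ.positive⁻¹ 1ℚ) in
    ℚ.<-irrefl ≡.refl (h N N ℕ.≤-refl ℕ.≤-refl)

  0≤p*p : ∀ p → 0ℚ ℚ.≤ p ℚ.* p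
  0≤p*p p with ℚ.≤-total 0ℚ p
  ... | inj₁ 0≤p = ℚ.nonNegative⁻¹ (p ℚ.* p) {{ℚ.nonNeg*nonNeg⇒nonNeg p {{0≤p′}} p {{0≤p′}}}}
    where
    0≤p′ = ℚ.nonNegative 0≤p
  ... | inj₂ p≤0 = ℚ.nonNegative⁻¹ (p ℚ.* p) {{ℚ.nonPos*nonPos⇒nonPos p {{p≤0′}} p {{p≤0′}}}}
    where
    p≤0′ = ℚ.nonPositive p≤0

  p*p<ε*ε⇒∣p∣<ε : ∀ p {ε} → 0ℚ ℚ.< ε → p ℚ.* p ℚ.< ε ℚ.* ε → ℚ.∣ p ∣ ℚ.< ε
  p*p<ε*ε⇒∣p∣<ε p {ε} 0<ε p²<ε² = ℚ.≰⇒> λ ε≤∣p∣ → ℚ.<-irrefl ≡.refl (begin-strict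
    p ℚ.* p                  <⟨ p²<ε² ⟩
    ε ℚ.* ε                  ≤⟨ ℚ.*-monoˡ-≤-nonNeg ε {{ℚ.nonNegative (ℚ.<⇒≤ 0<ε)}} ε≤∣p∣ ⟩
    ε ℚ.* ℚ.∣ p ∣            ≤⟨ ℚ.*-monoʳ-≤-nonNeg ℚ.∣ p ∣ {{ℚ.∣-∣-nonNeg p}} ε≤∣p∣ ⟩
    ℚ.∣ p ∣ ℚ.* ℚ.∣ p ∣      ≡⟨ ℚ.∣p*q∣≡∣p∣*∣q∣ p p ⟨
    ℚ.∣ p ℚ.* p ∣            ≡⟨ ℚ.0≤p⇒∣p∣≡p (0≤p*p p) ⟩
    p ℚ.* p                  ∎)
    where open ℚ.≤-Reasoning

  squareSum-nonNegative : ∀ {s} → SumOfSquares _+_ _*_ 0ℝ s → ∀ n → 0ℚ ℚ.≤ seq s n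
  squareSum-nonNegative empty    n = ℚ.≤-refl
  squareSum-nonNegative [ a ]²   n = 0≤p*p (seq a n)
  squareSum-nonNegative (s ⊞ t)  n = ℚ.+-mono-≤ (squareSum-nonNegative s n) (squareSum-nonNegative t n)

  -- Both summands are nonnegative at every index, so a sum within `ε ℚ.* ε` of 0 forces the terms
  -- of `x` to be smaller than `ε`.
  ℝ-formallyReal : ∀ x {s} → SumOfSquares _+_ _*_ 0ℝ s → x * x + s ≈ 0ℝ → x ≈ 0ℝ
  ℝ-formallyReal x {s} sq x²+s≈0 .seq-∼ .close ε 0<ε =
    let N , h = x²+s≈0 .seq-∼ .close (ε ℚ.* ε) 0<ε² in
    N , λ m n N≤m N≤n → ≡.subst (ℚ._< ε) (≡.sym (≡.cong ℚ.∣_∣ (ℚ.+-identityʳ (seq x m)))) (p*p<ε*ε⇒∣p∣<ε (seq x m) 0<ε (begin-strict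
      seq x m ℚ.* seq x m                                 ≡⟨ ℚ.+-identityʳ _ ⟨
      seq x m ℚ.* seq x m ℚ.+ 0ℚ                          ≤⟨ ℚ.+-monoʳ-≤ (seq x m ℚ.* seq x m) (squareSum-nonNegative sq m) ⟩
      seq x m ℚ.* seq x m ℚ.+ seq s m                     ≤⟨ p≤∣p∣ _ ⟩
      ℚ.∣ seq x m ℚ.* seq x m ℚ.+ seq s m ∣               ≡⟨ ≡.cong ℚ.∣_∣ (ℚ.+-identityʳ _) ⟨
      ℚ.∣ seq x m ℚ.* seq x m ℚ.+ seq s m ℚ.- 0ℚ ∣        <⟨ h m n N≤m N≤n ⟩
      ε ℚ.* ε                                             ∎))
    where
    open ℚ.≤-Reasoning
    0<ε² : 0ℚ ℚ.< ε ℚ.* ε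
    0<ε² = ≡.subst (ℚ._< ε ℚ.* ε) (ℚ.*-zeroʳ ε) (ℚ.*-monoʳ-<-pos ε {{ℚ.positive 0<ε}} 0<ε)
    p≤∣p∣ : ∀ p → p ℚ.≤ ℚ.∣ p ∣
    p≤∣p∣ p with ℚ.≤-total 0ℚ p
    ... | inj₁ 0≤p = ℚ.≤-reflexive (≡.sym (ℚ.0≤p⇒∣p∣≡p 0≤p))
    ... | inj₂ p≤0 = ℚ.≤-trans p≤0 (ℚ.0≤∣p∣ p)

  -- Pairs the form with a propositional equation for its coefficients, so that later the form can
  -- remain a variable.
  formWithCoefficients : ∀ {m n} (a : Fin m → Fin n → Fin m → Fin n → ℝ) →
    (∀ i j k l → a i j k l ≈ a k j i l) → (∀ i j k l → a i j k l ≈ a k l i j) →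
    ∃ λ (P : BiquadraticForm m n) → ∀ i j k l → BiquadraticForm.coeff P i j k l ≡ a i j k l
  formWithCoefficients a a-sym₁ a-sym₂ = record { coeff = a ; sym₁ = a-sym₁ ; sym₂ = a-sym₂ } , λ _ _ _ _ → ≡.refl

  open Abstracted ℝ-isCommutativeRing sum (λ _ → ≡.refl) evalBilinear (λ _ _ _ → ≡.refl)
    (fromℚ ½) ½ℝ+½ℝ≈1 1≉0 ℝ-formallyReal using (LabelCoefficients; labelCoefficients)

  module _ {m n N : ℕ} (label : Cell m n → Maybe (Fin N)) (rep : Fin N → Cell m n) (label-rep : ∀ a → label (rep a) ≡ just a)
    (determined : ∀ a b → Labelling.Determined label (rep a) (rep b)) where

    HasRank : Set
    HasRank = ∃ λ (P : BiquadraticForm m n) → IsSOSRank P N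

    labelForm-rank : HasRank
    labelForm-rank = from-coefficients (labelCoefficients label)
      where
      from-coefficients : LabelCoefficients label → HasRank
      from-coefficients coefficients = from-form (formWithCoefficients coeff sym₁ sym₂)
        where
        open LabelCoefficients coefficients
        from-form : (∃ λ (P : BiquadraticForm m n) → ∀ i j k l → BiquadraticForm.coeff P i j k l ≡ coeff i j k l) → HasRank
        from-form (P , P-coeff) =
          P , proj₁ sos , λ { r (f , P≈f²) → proj₂ sos rep label-rep determined r f P≈f² }
          where
          sos = ranks (BiquadraticForm.coeff P) P-coeff (evalBiquadratic P) (λ x y → ≡.refl)

-- Examples of augmented graphs

open import Data.Bool.Base using (true; false; if_then_else_; _∧_)
open import Data.Empty using (⊥; ⊥-elim)
open import Data.Fin.Base using (punchIn; punchOut; inject≤) renaming (_<_ to _<ᶠ_)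
open import Data.Fin.Patterns
import Data.Fin.Properties as Fin
open import Data.Fin.Subset using (Subset; inside; outside; ∣_∣; _∈_; _∉_)
import Data.Fin.Subset.Properties as Subset
open import Data.List.Base as List using (List; []; _∷_; length; tabulate)
import Data.List.Membership.Propositional as List
open import Data.List.Membership.Propositional using (find; lose)
open import Data.List.Membership.Propositional.Properties using (∈-lookup)
import Data.List.Properties as List
open import Data.List.Relation.Unary.All as All using (All; []; _∷_)
import Data.List.Relation.Unary.All.Properties as All
open import Data.List.Relation.Unary.AllPairs using (AllPairs; []; _∷_; allPairs?)
open import Data.List.Relation.Unary.Any as Any using (here; there)
open import Data.List.Relation.Unary.Linked using (_∷_)
open import Data.List.Relation.Unary.Unique.Propositional using (Unique)
import Data.List.Relation.Unary.Unique.Propositional.Properties as Unique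
import Data.Maybe.Properties as Maybe
open import Data.Nat.Base using (_+_; _*_; _≤_; z≤n; s≤s)
open import Data.Nat.Solver using (module +-*-Solver)
import Data.Product.Properties as Product
open import Data.Sum.Base as Sum using ()
open import Data.Vec.Base as Vec using (Vec; []; _∷_; lookup; here; there; _[_]≔_)
import Data.Vec.Properties as Vec
open import Function.Base using (case_of_)
open import Relation.Binary.Definitions using (DecidableEquality; tri<; tri≈; tri>)
open import Relation.Binary.PropositionalEquality
  using (_≢_; refl; sym; trans; cong; cong₂; subst; module ≡-Reasoning)
open import Relation.Nullary using (Dec; yes; no; contradiction)
open import Relation.Nullary.Decidable
  using (map′; ¬?; _×-dec_; _⊎-dec_; _→-dec_; from-yes; decidable-stable)
open import Relation.Nullary.Negation using (contradiction-irr)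
open import Relation.Unary using (Decidable)

anyCell? : ∀ {m n} {P : Cell m n → Set} → Decidable P → Dec (∃ P)
anyCell? P? = map′ (λ (i , j , p) → (i , j) , p) (λ ((i , j) , p) → i , j , p)
  (Fin.any? λ i → Fin.any? λ j → P? (i , j))

separated? : ∀ {m n} {Free : Cell m n → Set} → Decidable Free → ∀ c d → Dec (Separated Free c d)
separated? free? c d = (row c Fin.≟ row d) ⊎-dec (col c Fin.≟ col d) ⊎-dec free? (corner c d) ⊎-dec free? (corner d c)

module _ {m n N} (label : Cell m n → Maybe (Fin N)) where
  open Labelling label

  blank? : Decidable Blank
  blank? c = Maybe.≡-dec Fin._≟_ (label c) nothing

  linked? : ∀ c d → Dec (Linked c d)
  linked? c d = Maybe.≡-dec Fin._≟_ (label c) (label d) ×-dec separated? blank? c d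

  linkSeparated? : ∀ c d → Dec (LinkSeparated c d)
  linkSeparated? c d = anyCell? λ c′ → linked? c c′ ×-dec anyCell? λ d′ → linked? d d′ ×-dec separated? blank? c′ d′

  determined? : ∀ c d → Dec (Determined c d)
  determined? c d = linkSeparated? c d ⊎-dec linkSeparated? (corner c d) (corner d c)

pattern 10F = suc 9F
pattern 11F = suc 10F

-- The labels from 9 on belong to the 2-edges of weak₁₂ below.
labelTable : Vec (Vec (Maybe (Fin 12)) 3) 6
labelTable =
  (just 0F  ∷ just 1F  ∷ nothing  ∷ []) ∷
  (just 2F  ∷ nothing  ∷ just 3F  ∷ []) ∷
  (nothing  ∷ just 4F  ∷ just 5F  ∷ []) ∷
  (just 6F  ∷ just 9F  ∷ just 9F  ∷ []) ∷
  (just 10F ∷ just 7F  ∷ just 10F ∷ []) ∷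
  (just 11F ∷ just 11F ∷ just 8F  ∷ []) ∷ []

label₁₂ : Cell 6 3 → Maybe (Fin 12)
label₁₂ (i , j) = lookup (lookup labelTable i) j

representative : Fin 12 → Cell 6 3
representative = lookup
  ((0F , 0F) ∷ (0F , 1F) ∷ (1F , 0F) ∷ (1F , 2F) ∷ (2F , 1F) ∷ (2F , 2F) ∷
   (3F , 0F) ∷ (4F , 1F) ∷ (5F , 2F) ∷ (3F , 1F) ∷ (4F , 0F) ∷ (5F , 0F) ∷ [])

label-representative : ∀ a → label₁₂ (representative a) ≡ just a
label-representative = from-yes (Fin.all? λ a → Maybe.≡-dec Fin._≟_ (label₁₂ (representative a)) (just a))

-- The search through linked cells matters: both corners of `(3F , 1F)` and `(4F , 0F)` are 1-edges,
-- but the other halves of these 2-edges, `(3F , 2F)` and `(4F , 2F)`, share a column.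
representatives-determined : ∀ a b → Labelling.Determined label₁₂ (representative a) (representative b)
representatives-determined = from-yes (Fin.all? λ a → Fin.all? λ b → determined? label₁₂ (representative a) (representative b))

-- Decision procedures for the conditions on augmented graphs

module _ {m n : ℕ} where

  infix 4 _≟ᶜ_
  _≟ᶜ_ : DecidableEquality (Cell m n)
  _≟ᶜ_ = Product.≡-dec Fin._≟_ Fin._≟_

  _∈ᴳ?_ : ∀ (c : Cell m n) (G : BipartiteGraph m n) → Dec (c ∈ᴳ G)
  (i , j) ∈ᴳ? G = j Subset.∈? lookup G i

  c₄-free? : Decidable (C₄-Free {m} {n})
  c₄-free? G = ¬? (Fin.any? λ i → Fin.any? λ k → Fin.any? λ j → Fin.any? λ l →
    ¬? (i Fin.≟ k) ×-dec ¬? (j Fin.≟ l) ×-dec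
    ((i , j) ∈ᴳ? G) ×-dec ((i , l) ∈ᴳ? G) ×-dec ((k , j) ∈ᴳ? G) ×-dec ((k , l) ∈ᴳ? G))

  sameEdge? : (e f : TwoEdge m n) → Dec (SameEdge e f)
  sameEdge? e f = (half₁ e ≟ᶜ half₁ f ×-dec half₂ e ≟ᶜ half₂ f) ⊎-dec (half₁ e ≟ᶜ half₂ f ×-dec half₂ e ≟ᶜ half₁ f)

  halfOf? : (e : TwoEdge m n) → Decidable (HalfOf e)
  halfOf? e c = c ≟ᶜ half₁ e ⊎-dec c ≟ᶜ half₂ e

  nondegenerate? : Decidable (Nondegenerate {m} {n})
  nondegenerate? e = ¬? (row (half₁ e) Fin.≟ row (half₂ e)) ×-dec ¬? (col (half₁ e) Fin.≟ col (half₂ e))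

module _ {m n : ℕ} (G : AugmentedGraph m n) where

  open AugmentedGraph G

  occupied? : Decidable (Occupied G)
  occupied? c = (c ∈ᴳ? E₁) ⊎-dec
    map′ find (λ (e , e∈E₂ , c∈e) → lose e∈E₂ c∈e) (Any.any? (λ e → halfOf? e c) E₂)

  HalvesAvoid : TwoEdge m n → (Cell m n → Set) → Set
  HalvesAvoid e P = ¬ P (half₁ e) × ¬ P (half₂ e)

  halvesAvoid? : ∀ e {P} → Decidable P → Dec (HalvesAvoid e P)
  halvesAvoid? e P? = ¬? (P? (half₁ e)) ×-dec ¬? (P? (half₂ e))

  halves-avoid : ∀ e {P} → HalvesAvoid e P → ∀ c → HalfOf e c → ¬ P c
  halves-avoid e (¬P₁ , ¬P₂) c (inj₁ refl) = ¬P₁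
  halves-avoid e (¬P₁ , ¬P₂) c (inj₂ refl) = ¬P₂

  condS? : Dec (All (λ e → HalvesAvoid e (_∈ᴳ E₁)) E₂ ×
                All (λ e → All (λ f → SameEdge e f ⊎ HalvesAvoid e (HalfOf f)) E₂) E₂)
  condS? = All.all? (λ e → halvesAvoid? e (_∈ᴳ? E₁)) E₂ ×-dec
           All.all? (λ e → All.all? (λ f → sameEdge? e f ⊎-dec halvesAvoid? e (halfOf? f)) E₂) E₂

  condS : All (λ e → HalvesAvoid e (_∈ᴳ E₁)) E₂ ×
          All (λ e → All (λ f → SameEdge e f ⊎ HalvesAvoid e (HalfOf f)) E₂) E₂ → CondS G
  condS (avoid-E₁ , avoid-E₂) =
    (λ e e∈E₂ → halves-avoid e {_∈ᴳ E₁} (All.lookup avoid-E₁ e∈E₂)) ,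
    (λ e f e∈E₂ f∈E₂ e≉f → case All.lookup (All.lookup avoid-E₂ e∈E₂) f∈E₂ of λ where
      (inj₁ e≈f)   → contradiction e≈f e≉f
      (inj₂ avoid) → halves-avoid e {HalfOf f} avoid)

  SeparatedFrom : TwoEdge m n → Cell m n → Set
  SeparatedFrom e d = ∃ λ c → HalfOf e c × Separated (λ c → ¬ Occupied G c) c d

  separatedFrom? : ∀ e d → Dec (SeparatedFrom e d)
  separatedFrom? e d = anyCell? λ c → halfOf? e c ×-dec separated? (λ c → ¬? (occupied? c)) c d

  -- A finite check on cells in place of vertex-disjoint pairs: a single suitable cell from each
  -- edge settles (W3) for the pair.
  W3Witnesses : Set
  W3Witnesses = All (λ e → (∀ i j → (i , j) ∈ᴳ E₁ → SeparatedFrom e (i , j)) ×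
                           All (λ f → SeparatedFrom e (half₁ f) ⊎ SeparatedFrom e (half₂ f)) E₂) E₂

  w3Witnesses? : Dec W3Witnesses
  w3Witnesses? = All.all? (λ e →
    (Fin.all? λ i → Fin.all? λ j → ((i , j) ∈ᴳ? E₁) →-dec separatedFrom? e (i , j)) ×-dec
    All.all? (λ f → separatedFrom? e (half₁ f) ⊎-dec separatedFrom? e (half₂ f)) E₂) E₂

  -- A shared row or column refutes vertex-disjointness; otherwise the free corner is an opposite
  -- cell of the pair.
  separated-opposite : ∀ {e f : Edge G} {c d} → CellOf G e c → CellOf G f d → Separated (λ c → ¬ Occupied G c) c d →
    VertexDisjoint G e f → ∃ λ c → OppositeCell G e f c × ¬ Occupied G c
  separated-opposite {c = c} {d} c∈e d∈f (inj₁ same-row) (rows , cols) =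
    ⊥-elim (rows (row c) ((c , c∈e , refl) , d , d∈f , sym same-row))
  separated-opposite {c = c} {d} c∈e d∈f (inj₂ (inj₁ same-col)) (rows , cols) =
    ⊥-elim (cols (col c) ((c , c∈e , refl) , d , d∈f , sym same-col))
  separated-opposite {c = c} {d} c∈e d∈f (inj₂ (inj₂ (inj₁ free))) disjoint =
    corner c d , inj₁ ((c , c∈e , refl) , d , d∈f , refl) , free
  separated-opposite {c = c} {d} c∈e d∈f (inj₂ (inj₂ (inj₂ free))) disjoint =
    corner d c , inj₂ ((d , d∈f , refl) , c , c∈e , refl) , free

  condW3 : W3Witnesses → CondW3 G
  condW3 witnesses e e∈E₂ f disjoint with All.lookup witnesses e∈E₂
  condW3 witnesses e e∈E₂ f@(inj₁ (d , d∈E₁)) disjoint | to-cell , _ =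
    let c , c∈e , sep = to-cell (row d) (col d) d∈E₁ in
    separated-opposite {inj₂ (e , e∈E₂)} {f} c∈e refl sep disjoint
  condW3 witnesses e e∈E₂ f@(inj₂ (g , g∈E₂)) disjoint | _ , to-edge with All.lookup to-edge g∈E₂
  ... | inj₁ (c , c∈e , sep) = separated-opposite {inj₂ (e , e∈E₂)} {f} c∈e (inj₁ refl) sep disjoint
  ... | inj₂ (c , c∈e , sep) = separated-opposite {inj₂ (e , e∈E₂)} {f} c∈e (inj₂ refl) sep disjoint

  AllDegenerate : Set
  AllDegenerate = All (λ e → ¬ Nondegenerate e) E₂

  allDegenerate? : Dec AllDegenerate
  allDegenerate? = All.all? (λ e → ¬? (nondegenerate? e)) E₂

  degenerate-no-arc : AllDegenerate → ∀ {e f} → ¬ DependencyArc G e f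
  degenerate-no-arc degenerate arc = All.lookup degenerate source∈E₂ source-nondeg
    where open DependencyArc arc

  -- Every cycle has a first arc, and its source is nondegenerate. Splitting the list exposes that
  -- arc.
  degenerate-W2 : AllDegenerate → CondW2 G
  degenerate-W2 degenerate e []      (_ , arc ∷ _) = ⊥-elim (degenerate-no-arc degenerate arc)
  degenerate-W2 degenerate e (_ ∷ _) (_ , arc ∷ _) = ⊥-elim (degenerate-no-arc degenerate arc)

  degenerate-W2′ : AllDegenerate → CondW2′ G
  degenerate-W2′ degenerate (e , e∈E₂ , nondeg , _) = All.lookup degenerate e∈E₂ nondeg

  degenerate-condition2 : AllDegenerate → Condition2 G
  degenerate-condition2 degenerate (e , e∈E₂ , nondeg , _) = All.lookup degenerate e∈E₂ nondeg

  condition3? : Dec (Condition3 G)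
  condition3? = ¬? (map′ find (λ (e , e∈E₂ , p) → lose e∈E₂ p) (Any.any? violated? E₂))
    where
    violated? = λ (e : TwoEdge m n) → let (i , j) = half₁ e ; (p , q) = half₂ e in
      Fin.any? λ k → Fin.any? λ l →
        ¬? (k Fin.≟ i) ×-dec ¬? (k Fin.≟ p) ×-dec ¬? (l Fin.≟ j) ×-dec ¬? (l Fin.≟ q) ×-dec
        occupied? (k , l) ×-dec occupied? (k , j) ×-dec occupied? (k , q) ×-dec occupied? (i , l) ×-dec occupied? (p , l)

-- A weak admissible graph with 12 edges and an admissible one with 11

extremal₉ : BipartiteGraph 6 3
extremal₉ =
  (inside  ∷ inside  ∷ outside ∷ []) ∷
  (inside  ∷ outside ∷ inside  ∷ []) ∷
  (outside ∷ inside  ∷ inside  ∷ []) ∷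
  (inside  ∷ outside ∷ outside ∷ []) ∷
  (outside ∷ inside  ∷ outside ∷ []) ∷
  (outside ∷ outside ∷ inside  ∷ []) ∷ []

extremal₉-C₄-free : C₄-Free extremal₉
extremal₉-C₄-free = from-yes (c₄-free? extremal₉)

-- Each row with one 1-edge is completed by a row-degenerate 2-edge. The three unoccupied cells lie
-- in the other rows, one in each column.
weak₁₂ : AugmentedGraph 6 3
weak₁₂ = record
  { E₁       = extremal₉
  ; E₂       = edges
  ; E₂-isSet = from-yes (allPairs? (λ e f → ¬? (sameEdge? e f)) edges)
  }
  where
  edges : List (TwoEdge 6 3)
  edges = twoEdge (3F , 1F) (3F , 2F) (λ ()) ∷ twoEdge (4F , 0F) (4F , 2F) (λ ()) ∷ twoEdge (5F , 0F) (5F , 1F) (λ ()) ∷ []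

weak₁₂-weakAdmissible : WeakAdmissible weak₁₂
weak₁₂-weakAdmissible =
  condS weak₁₂ (from-yes (condS? weak₁₂)) , extremal₉-C₄-free ,
  degenerate-W2 weak₁₂ degenerate , degenerate-W2′ weak₁₂ degenerate ,
  condW3 weak₁₂ (from-yes (w3Witnesses? weak₁₂))
  where
  degenerate = from-yes (allDegenerate? weak₁₂)

-- The last row is the only full one, so Condition 3 cannot fail at the row-degenerate 2-edge. The
-- two rows of the column-degenerate 2-edge have no common occupied column besides its own.
admissible₁₁ : AugmentedGraph 6 3
admissible₁₁ = record
  { E₁       = extremal₉
  ; E₂       = edges
  ; E₂-isSet = from-yes (allPairs? (λ e f → ¬? (sameEdge? e f)) edges)
  }
  where
  edges : List (TwoEdge 6 3)
  edges = twoEdge (3F , 2F) (4F , 2F) (λ ()) ∷ twoEdge (5F , 0F) (5F , 1F) (λ ()) ∷ []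

admissible₁₁-admissible : Admissible admissible₁₁
admissible₁₁-admissible =
  condS admissible₁₁ (from-yes (condS? admissible₁₁)) , extremal₉-C₄-free ,
  degenerate-condition2 admissible₁₁ (from-yes (allDegenerate? admissible₁₁)) ,
  from-yes (condition3? admissible₁₁)

-- C₄-free graphs with three columns

rowSum : ∀ {m n} → (Subset n → ℕ) → BipartiteGraph m n → ℕ
rowSum f G = Vec.sum (Vec.map f G)

both : ∀ {n} → Fin n → Fin n → Subset n → ℕ
both j l s = if lookup s j ∧ lookup s l then 1 else 0

-- The slack in `d ≤ 1 + d(d-1)/2` for a row of degree `d`; among 0 to 3, the inequality is tight
-- for 1 and 2.
defect : Subset 3 → ℕ
defect (outside ∷ outside ∷ outside ∷ []) = 1
defect (inside  ∷ inside  ∷ inside  ∷ []) = 1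
defect _                                  = 0

pairs : ∀ {m} → BipartiteGraph m 3 → ℕ
pairs G = rowSum (both 0F 1F) G + rowSum (both 0F 2F) G + rowSum (both 1F 2F) G

row-count : ∀ s → ∣ s ∣ + defect s ≡ 1 + (both 0F 1F s + both 0F 2F s + both 1F 2F s)
row-count (outside ∷ outside ∷ outside ∷ []) = refl
row-count (outside ∷ outside ∷ inside  ∷ []) = refl
row-count (outside ∷ inside  ∷ outside ∷ []) = refl
row-count (outside ∷ inside  ∷ inside  ∷ []) = refl
row-count (inside  ∷ outside ∷ outside ∷ []) = refl
row-count (inside  ∷ outside ∷ inside  ∷ []) = refl
row-count (inside  ∷ inside  ∷ outside ∷ []) = refl
row-count (inside  ∷ inside  ∷ inside  ∷ []) = refl

edgeCount+defect : ∀ {m} (G : BipartiteGraph m 3) → edgeCount G + rowSum defect G ≡ m + pairs G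
edgeCount+defect []                = refl
edgeCount+defect {suc m} (s ∷ G)   = begin
  (∣ s ∣ + edgeCount G) + (defect s + rowSum defect G)
    ≡⟨ solve 4 (λ a b c d → (a :+ b) :+ (c :+ d) := (a :+ c) :+ (b :+ d)) refl (∣ s ∣) (edgeCount G) (defect s) (rowSum defect G) ⟩
  (∣ s ∣ + defect s) + (edgeCount G + rowSum defect G)
    ≡⟨ cong₂ _+_ (row-count s) (edgeCount+defect G) ⟩
  (1 + (both 0F 1F s + both 0F 2F s + both 1F 2F s)) + (m + pairs G)
    ≡⟨ solve 7 (λ m a b c A B C → (con 1 :+ (a :+ b :+ c)) :+ (m :+ (A :+ B :+ C))
         := (con 1 :+ m) :+ ((a :+ A) :+ (b :+ B) :+ (c :+ C))) refl
         m (both 0F 1F s) (both 0F 2F s) (both 1F 2F s) (rowSum (both 0F 1F) G) (rowSum (both 0F 2F) G) (rowSum (both 1F 2F) G) ⟩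
  suc m + pairs (s ∷ G) ∎
  where
  open ≡-Reasoning
  open +-*-Solver

InRow : ∀ {m n} → Fin n → Fin n → BipartiteGraph m n → Fin m → Set
InRow j l G i = (i , j) ∈ᴳ G × (i , l) ∈ᴳ G

module _ {n} (j l : Fin n) where

  both-positive : ∀ s → 1 ≤ both j l s → j ∈ s × l ∈ s
  both-positive s 1≤ with lookup s j in eq | lookup s l in eq′
  ... | true | true = Vec.lookup⇒[]= j s eq , Vec.lookup⇒[]= l s eq′

  both≤1 : ∀ s → both j l s ≤ 1
  both≤1 s with lookup s j ∧ lookup s l
  ... | true  = s≤s z≤n
  ... | false = z≤n

  rowSum-both-positive : ∀ {m} (G : BipartiteGraph m n) → 1 ≤ rowSum (both j l) G → ∃ (InRow j l G)
  rowSum-both-positive (s ∷ G) 1≤ with both j l s in eq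
  ... | suc _ = zero , both-positive s (subst (1 ≤_) (sym eq) (s≤s z≤n))
  ... | zero  = let i , p = rowSum-both-positive G 1≤ in suc i , p

  rowSum-both≤1 : ∀ {m} (G : BipartiteGraph m n) → (∀ i k → i ≢ k → InRow j l G i → ¬ InRow j l G k) → rowSum (both j l) G ≤ 1
  rowSum-both≤1 []      unique = z≤n
  rowSum-both≤1 (s ∷ G) unique with both j l s in eq
  ... | zero = rowSum-both≤1 G λ i k i≢k → unique (suc i) (suc k) (λ eq → i≢k (Fin.suc-injective eq))
  ... | suc b = ℕ.≤-trans (ℕ.+-mono-≤ (ℕ.≤-trans (ℕ.≤-reflexive (sym eq)) (both≤1 s))
      (ℕ.≮⇒≥ λ 1≤ → let i , p = rowSum-both-positive G 1≤ in
        unique zero (suc i) (λ ()) (both-positive s (subst (1 ≤_) (sym eq) (s≤s z≤n))) p)) ℕ.≤-refl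

rowSum-zero : ∀ {m n} (f : Subset n → ℕ) (G : BipartiteGraph m n) → rowSum f G ≡ 0 → ∀ i → f (lookup G i) ≡ 0
rowSum-zero f (s ∷ G) eq zero    = ℕ.m+n≡0⇒m≡0 (f s) eq
rowSum-zero f (s ∷ G) eq (suc i) = rowSum-zero f G (ℕ.m+n≡0⇒n≡0 (f s) eq) i

module _ {m} (G : BipartiteGraph m 3) (c₄-free : C₄-Free G) where

  pair≤1 : ∀ j l → j ≢ l → rowSum (both j l) G ≤ 1
  pair≤1 j l j≢l = rowSum-both≤1 j l G λ i k i≢k (ij , il) (kj , kl) →
    c₄-free (i , k , j , l , i≢k , j≢l , ij , il , kj , kl)

  -- The total defect is kept on the left so that equality in the edge bound rules out rows of
  -- degree 0 and 3.
  edgeCount≤ : edgeCount G + rowSum defect G ≤ m + 3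
  edgeCount≤ = subst (_≤ m + 3) (sym (edgeCount+defect G)) (ℕ.+-monoʳ-≤ m
    (ℕ.+-mono-≤ (ℕ.+-mono-≤ (pair≤1 0F 1F λ ()) (pair≤1 0F 2F λ ())) (pair≤1 1F 2F λ ())))

  module Extremal (extremal : edgeCount G ≡ m + 3) where

    no-defect : ∀ i → defect (lookup G i) ≡ 0
    no-defect = rowSum-zero defect G (ℕ.n≤0⇒n≡0 (ℕ.+-cancelˡ-≤ (m + 3) (rowSum defect G) 0
      (ℕ.≤-trans (subst (λ e → e + rowSum defect G ≤ m + 3) extremal edgeCount≤) (ℕ.≤-reflexive (sym (ℕ.+-identityʳ (m + 3)))))))

    3≤pairs : 3 ≤ pairs G
    3≤pairs = ℕ.+-cancelˡ-≤ m 3 (pairs G) (subst (m + 3 ≤_) (edgeCount+defect G)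
      (subst (λ e → m + 3 ≤ e + rowSum defect G) (sym extremal) (ℕ.m≤m+n (m + 3) (rowSum defect G))))

    -- The three pair counts are at most 1 each and sum to at least 3, so none of them is 0.
    rowWith : ∀ j l → j ≢ l → ∃ (InRow j l G)
    rowWith = λ where
        0F 1F _ → row₀₁
        1F 0F _ → swap row₀₁
        0F 2F _ → row₀₂
        2F 0F _ → swap row₀₂
        1F 2F _ → row₁₂
        2F 1F _ → swap row₁₂
        0F 0F 0≢0 → contradiction refl 0≢0
        1F 1F 1≢1 → contradiction refl 1≢1
        2F 2F 2≢2 → contradiction refl 2≢2
      where
      swap : ∀ {j l} → ∃ (InRow j l G) → ∃ (InRow l j G)
      swap (i , ij , il) = i , il , ij
      row₀₁ = rowSum-both-positive 0F 1F G (ℕ.≮⇒≥ λ a<1 → ℕ.<⇒≱ (ℕ.+-mono-<-≤ (ℕ.+-mono-<-≤ a<1 (pair≤1 0F 2F λ ())) (pair≤1 1F 2F λ ())) 3≤pairs)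
      row₀₂ = rowSum-both-positive 0F 2F G (ℕ.≮⇒≥ λ b<1 → ℕ.<⇒≱ (ℕ.+-mono-<-≤ (ℕ.+-mono-≤-< (pair≤1 0F 1F λ ()) b<1) (pair≤1 1F 2F λ ())) 3≤pairs)
      row₁₂ = rowSum-both-positive 1F 2F G (ℕ.≮⇒≥ λ c<1 → ℕ.<⇒≱ (ℕ.+-mono-≤-< (ℕ.+-mono-≤ (pair≤1 0F 1F λ ()) (pair≤1 0F 2F λ ())) c<1) 3≤pairs)

    row-nonempty : ∀ i → ∃ λ j → (i , j) ∈ᴳ G
    row-nonempty i with lookup G i | no-defect i
    ... | inside  ∷ _       ∷ _       ∷ [] | _ = 0F , here
    ... | outside ∷ inside  ∷ _       ∷ [] | _ = 1F , there here
    ... | outside ∷ outside ∷ inside  ∷ [] | _ = 2F , there (there here)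

    row-not-full : ∀ i → ¬ (∀ j → (i , j) ∈ᴳ G)
    row-not-full i full with lookup G i | no-defect i | full 0F | full 1F | full 2F
    ... | inside ∷ inside ∷ inside ∷ [] | () | here | there here | there (there here)

-- Upper bounds on the number of 2-edges

fill : ∀ {m n} → BipartiteGraph m n → Cell m n → BipartiteGraph m n
fill G (i , j) = Vec.updateAt G i (_[ j ]≔ inside)

∣insert∣ : ∀ {n} (s : Subset n) j → j ∉ s → ∣ s [ j ]≔ inside ∣ ≡ suc ∣ s ∣
∣insert∣ (inside  ∷ s) zero    j∉s = contradiction here j∉s
∣insert∣ (outside ∷ s) zero    j∉s = refl
∣insert∣ (inside  ∷ s) (suc j) j∉s = cong suc (∣insert∣ s j λ j∈s → j∉s (there j∈s))
∣insert∣ (outside ∷ s) (suc j) j∉s = ∣insert∣ s j λ j∈s → j∉s (there j∈s)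

edgeCount-fill : ∀ {m n} (G : BipartiteGraph m n) c → ¬ c ∈ᴳ G → edgeCount (fill G c) ≡ suc (edgeCount G)
edgeCount-fill (s ∷ G) (zero  , j) c∉G = cong (_+ edgeCount G) (∣insert∣ s j c∉G)
edgeCount-fill (s ∷ G) (suc i , j) c∉G = trans (cong (∣ s ∣ +_) (edgeCount-fill G (i , j) c∉G)) (ℕ.+-suc ∣ s ∣ (edgeCount G))

∈-fill⁻ : ∀ {m n} (G : BipartiteGraph m n) c d → d ∈ᴳ fill G c → c ≡ d ⊎ d ∈ᴳ G
∈-fill⁻ G (i , j) (k , l) d∈ with k Fin.≟ i
... | no k≢i = inj₂ (subst (l ∈_) (Vec.lookup∘updateAt′ k i k≢i G) d∈)
... | yes refl with l Fin.≟ j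
...   | yes refl = inj₁ refl
...   | no  l≢j  = inj₂ (Vec.lookup⇒[]= l (lookup G k) (begin
    lookup (lookup G k) l                        ≡⟨ Vec.lookup∘update′ l≢j (lookup G k) inside ⟨
    lookup (lookup G k [ j ]≔ inside) l          ≡⟨ cong (λ s → lookup s l) (Vec.lookup∘updateAt k G) ⟨
    lookup (lookup (fill G (k , j)) k) l         ≡⟨ Vec.[]=⇒lookup d∈ ⟩
    inside                                       ∎))
  where open ≡-Reasoning

edgeCount≤cells : ∀ {m n} (G : BipartiteGraph m n) → edgeCount G ≤ m * n
edgeCount≤cells []      = z≤n
edgeCount≤cells (s ∷ G) = ℕ.+-mono-≤ (Subset.∣p∣≤n s) (edgeCount≤cells G)

-- Adds the cells to the graph one at a time. Each raises the edge count by one, and the count never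
-- exceeds the number of cells.
unique+edgeCount≤cells : ∀ {m n} (G : BipartiteGraph m n) {cs} → Unique cs → All (λ c → ¬ c ∈ᴳ G) cs →
                         length cs + edgeCount G ≤ m * n
unique+edgeCount≤cells G [] [] = edgeCount≤cells G
unique+edgeCount≤cells {m} {n} G {c ∷ cs} (c≢cs ∷ cs!) (c∉G ∷ cs∉G) = subst (_≤ m * n)
  (trans (cong (length cs +_) (edgeCount-fill G c c∉G)) (ℕ.+-suc (length cs) (edgeCount G)))
  (unique+edgeCount≤cells (fill G c) cs! (All.zipWith outside-fill (c≢cs , cs∉G)))
  where
  outside-fill : ∀ {d} → c ≢ d × ¬ d ∈ᴳ G → ¬ d ∈ᴳ fill G c
  outside-fill (c≢d , d∉G) d∈ = Sum.[ c≢d , d∉G ] (∈-fill⁻ G c _ d∈)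

module _ {m n : ℕ} where

  half₁≢half₂ : ∀ (e : TwoEdge m n) → half₁ e ≢ half₂ e
  half₁≢half₂ (twoEdge _ _ distinct) eq = contradiction-irr distinct λ ne → ne eq

  halves : List (TwoEdge m n) → List (Cell m n)
  halves []       = []
  halves (e ∷ es) = half₁ e ∷ half₂ e ∷ halves es

  length-halves : ∀ es → length (halves es) ≡ 2 * length es
  length-halves []       = refl
  length-halves (e ∷ es) = trans (cong (λ k → 2 + k) (length-halves es)) (sym (ℕ.*-suc 2 (length es)))

  ∈-halves : ∀ {es c} → c List.∈ halves es → ∃ λ e → e List.∈ es × HalfOf e c
  ∈-halves {e ∷ es} (here refl)         = e , here refl , inj₁ refl
  ∈-halves {e ∷ es} (there (here refl)) = e , here refl , inj₂ refl
  ∈-halves {e ∷ es} (there (there c∈))  = let f , f∈es , c∈f = ∈-halves c∈ in f , there f∈es , c∈f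

  halves-unique : ∀ {es : List (TwoEdge m n)} → AllPairs (λ e f → ¬ SameEdge e f) es →
    (∀ e f → e List.∈ es → f List.∈ es → ¬ SameEdge e f → ∀ c → HalfOf e c → ¬ HalfOf f c) → Unique (halves es)
  halves-unique [] disjoint = []
  halves-unique {e ∷ es} (e≉es ∷ es!) disjoint =
    ((λ eq → half₁≢half₂ e eq) ∷ avoid (inj₁ refl)) ∷ avoid (inj₂ refl) ∷
    halves-unique es! λ f g f∈es g∈es → disjoint f g (there f∈es) (there g∈es)
    where
    avoid : ∀ {c} → HalfOf e c → All (c ≢_) (halves es)
    avoid {c} c∈e = All.tabulate λ { d∈ refl → let f , f∈es , d∈f = ∈-halves d∈ in
      disjoint e f (here refl) (there f∈es) (All.lookup e≉es f∈es) c c∈e d∈f }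

module _ {m n : ℕ} (G : AugmentedGraph m n) (condS : CondS G) where

  open AugmentedGraph G

  -- Unoccupied cells, halves and 1-edges are pairwise disjoint, and by (S) no half is counted
  -- twice.
  unoccupied-bound : ∀ {us} → Unique us → All (λ c → ¬ Occupied G c) us →
                     (length us + 2 * length E₂) + edgeCount E₁ ≤ m * n
  unoccupied-bound {us} us! us-free = subst (λ k → k + edgeCount E₁ ≤ m * n)
    (trans (List.length-++ us) (cong (length us +_) (length-halves E₂)))
    (unique+edgeCount≤cells E₁
      (Unique.++⁺ us! (halves-unique E₂-isSet (proj₂ condS))
        (λ (c∈us , c∈halves) → All.lookup us-free c∈us (inj₂ (∈-halves c∈halves))))
      (All.++⁺ (All.map (λ free c∈E₁ → free (inj₁ c∈E₁)) us-free)
        (All.tabulate λ c∈halves → let e , e∈E₂ , c∈e = ∈-halves c∈halves in proj₁ condS e e∈E₂ _ c∈e)))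

-- Abstract because with-abstraction would unfold the decision procedures
-- on open terms.
abstract
  third : (j l : Fin 3) → ∃ λ k → k ≢ j × k ≢ l
  third = from-yes (Fin.all? λ (j : Fin 3) → Fin.all? λ (l : Fin 3) → Fin.any? λ (k : Fin 3) → ¬? (k Fin.≟ j) ×-dec ¬? (k Fin.≟ l))

  exhausted : (j l k o : Fin 3) → j ≢ l → k ≢ j → k ≢ l → o ≡ j ⊎ o ≡ l ⊎ o ≡ k
  exhausted = from-yes (Fin.all? λ (j : Fin 3) → Fin.all? λ (l : Fin 3) → Fin.all? λ (k : Fin 3) → Fin.all? λ (o : Fin 3) →
    ¬? (j Fin.≟ l) →-dec (¬? (k Fin.≟ j) →-dec (¬? (k Fin.≟ l) →-dec
    (o Fin.≟ j ⊎-dec o Fin.≟ l ⊎-dec o Fin.≟ k))))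

-- Names both halves without fixing their order, so that an argument about one half transfers to the
-- other through `ends-swap`.
data Ends {m n} (e : TwoEdge m n) (a b : Cell m n) : Set where
  forward  : half₁ e ≡ a → half₂ e ≡ b → Ends e a b
  backward : half₁ e ≡ b → half₂ e ≡ a → Ends e a b

module _ {m n : ℕ} {e : TwoEdge m n} where

  ends-swap : ∀ {a b} → Ends e a b → Ends e b a
  ends-swap (forward p q)  = backward p q
  ends-swap (backward p q) = forward p q

  ends-half : ∀ {a b} → Ends e a b → HalfOf e a
  ends-half (forward refl refl) = inj₁ refl
  ends-half (backward refl refl) = inj₂ refl

  ends-cover : ∀ {a b c} → Ends e a b → HalfOf e c → c ≡ a ⊎ c ≡ b
  ends-cover (forward refl refl) c∈e = c∈e
  ends-cover (backward refl refl) c∈e = Sum.swap c∈e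

  ends-distinct : ∀ {a b} → Ends e a b → a ≢ b
  ends-distinct (forward refl refl) eq = half₁≢half₂ e eq
  ends-distinct (backward refl refl) eq = half₁≢half₂ e (sym eq)

half-ends : ∀ {m n} (e : TwoEdge m n) {a} → HalfOf e a → ∃ (Ends e a)
half-ends e (inj₁ refl) = half₂ e , forward refl refl
half-ends e (inj₂ refl) = half₁ e , backward refl refl

avoiding : ∀ (i p : Fin 6) → ∃ λ (f : Fin 4 → Fin 6) → (∀ {a b} → f a ≡ f b → a ≡ b) × (∀ a → f a ≢ i × f a ≢ p)
avoiding i p = (λ a → punchIn i (punchIn q a)) ,
  (λ eq → Fin.punchIn-injective q _ _ (Fin.punchIn-injective i _ _ eq)) ,
  (λ a → Fin.punchInᵢ≢i i _ , avoid-p a)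
  where
  -- If `i ≡ p`, only one row has to be avoided, and the second hole is arbitrary.
  hole : Dec (i ≡ p) → Fin 5
  hole (yes _)  = 0F
  hole (no i≢p) = punchOut i≢p
  q = hole (i Fin.≟ p)
  avoid-p : ∀ a → punchIn i (punchIn q a) ≢ p
  avoid-p a eq with i Fin.≟ p
  ... | yes refl = Fin.punchInᵢ≢i i _ eq
  ... | no i≢p   = Fin.punchInᵢ≢i (punchOut i≢p) a
    (Fin.punchIn-injective i _ _ (trans eq (sym (Fin.punchIn-punchOut i≢p))))

allPairs-lookup : ∀ {A : Set} {R : A → A → Set} {xs} → AllPairs R xs →
                  ∀ {a b} → a <ᶠ b → R (List.lookup xs a) (List.lookup xs b)
allPairs-lookup (x∼xs ∷ xs!) {zero}  {suc b} _         = All.lookup x∼xs (∈-lookup b)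
allPairs-lookup (x∼xs ∷ xs!) {suc a} {suc b} (s≤s a<b) = allPairs-lookup xs! a<b

unique-lookup-injective : ∀ {A : Set} {xs : List A} → Unique xs → ∀ {a b} → List.lookup xs a ≡ List.lookup xs b → a ≡ b
unique-lookup-injective xs! {a} {b} eq with Fin.<-cmp a b
... | tri< a<b _ _ = contradiction eq (allPairs-lookup xs! a<b)
... | tri≈ _ a≡b _ = a≡b
... | tri> _ _ b<a = contradiction (sym eq) (allPairs-lookup xs! b<a)

-- Limited 6 × 3 graphs: at most three 2-edges under the weak conditions, at most two under the
-- original ones

module Bounds (G : AugmentedGraph 6 3) (edges₉ : edgeCount (AugmentedGraph.E₁ G) ≡ 9)
  (condS : CondS G) (c₄-free : CondW1 G) where

  open AugmentedGraph G
  open Extremal E₁ c₄-free edges₉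

  Free : Cell 6 3 → Set
  Free c = ¬ Occupied G c

  few-free : ∀ {us} → Unique us → All Free us → length us + 2 * length E₂ ≤ 9
  few-free {us} us! us-free = ℕ.+-cancelʳ-≤ 9 (length us + 2 * length E₂) 9
    (subst (λ k → (length us + 2 * length E₂) + k ≤ 18) edges₉ (unoccupied-bound G condS us! us-free))

  module _ {e} (e∈E₂ : e List.∈ E₂) where

    half∉E₁ : ∀ {c} → HalfOf e c → ¬ c ∈ᴳ E₁
    half∉E₁ = proj₁ condS e e∈E₂ _

    ends∉E₁ : ∀ {a b} → Ends e a b → ¬ a ∈ᴳ E₁
    ends∉E₁ ends = half∉E₁ (ends-half ends)

  shared-half : ∀ {e f c} → e List.∈ E₂ → f List.∈ E₂ → HalfOf e c → HalfOf f c → SameEdge e f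
  shared-half {e} {f} {c} e∈E₂ f∈E₂ c∈e c∈f =
    decidable-stable (sameEdge? e f) λ e≉f → proj₂ condS e f e∈E₂ f∈E₂ e≉f c c∈e c∈f

  module Weak (w2′ : CondW2′ G) (w3 : CondW3 G) (4≤E₂ : 4 ≤ length E₂) where

    -- At least eight of the nine cells outside `E₁` are halves.
    free-unique : ∀ {c d} → Free c → Free d → c ≡ d
    free-unique {c} {d} c-free d-free = decidable-stable (c ≟ᶜ d) λ c≢d →
      ℕ.<⇒≱ (ℕ.n<1+n 9) (ℕ.≤-trans (ℕ.+-monoʳ-≤ 2 (ℕ.*-monoʳ-≤ 2 4≤E₂))
        (few-free ((c≢d ∷ []) ∷ [] ∷ []) (c-free ∷ d-free ∷ [])))

    free-column : ∀ {c d} → Free c → Free d → col c ≡ col d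
    free-column c-free d-free = cong col (free-unique c-free d-free)

    opposite-of-1-edge : ∀ {e i j p q k l} → e List.∈ E₂ → Ends e (i , j) (p , q) → (k , l) ∈ᴳ E₁ →
      k ≢ i → k ≢ p → l ≢ j → l ≢ q → Free (i , l) ⊎ Free (p , l) ⊎ Free (k , j) ⊎ Free (k , q)
    opposite-of-1-edge {e} {i} {j} {p} {q} {k} {l} e∈E₂ ends kl∈E₁ k≢i k≢p l≢j l≢q
      with w3 e e∈E₂ (inj₁ ((k , l) , kl∈E₁)) (disjoint-rows , disjoint-cols)
      where
      disjoint-rows : ∀ r → ¬ (RowOf G (inj₂ (e , e∈E₂)) r × RowOf G (inj₁ ((k , l) , kl∈E₁)) r)
      disjoint-rows r ((c , c∈e , refl) , _ , refl , eq) =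
        Sum.[ (λ { refl → k≢i eq }) , (λ { refl → k≢p eq }) ] (ends-cover ends c∈e)
      disjoint-cols : ∀ r → ¬ (ColOf G (inj₂ (e , e∈E₂)) r × ColOf G (inj₁ ((k , l) , kl∈E₁)) r)
      disjoint-cols r ((c , c∈e , refl) , _ , refl , eq) =
        Sum.[ (λ { refl → l≢j eq }) , (λ { refl → l≢q eq }) ] (ends-cover ends c∈e)
    ... | _ , inj₁ ((c , c∈e , refl) , _ , refl , refl) , free with ends-cover ends c∈e
    ...   | inj₁ refl = inj₁ free
    ...   | inj₂ refl = inj₂ (inj₁ free)
    opposite-of-1-edge e∈E₂ ends kl∈E₁ k≢i k≢p l≢j l≢q
        | _ , inj₂ ((_ , refl , refl) , c , c∈e , refl) , free with ends-cover ends c∈e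
    ...   | inj₁ refl = inj₂ (inj₂ (inj₁ free))
    ...   | inj₂ refl = inj₂ (inj₂ (inj₂ free))

    -- (W3) for the 2-edge and the 1-edge (k , l), whose opposite cell
    -- (k , q) is a 1-edge.
    opposite-of-pair : ∀ {e i j p q k l} → e List.∈ E₂ → Ends e (i , j) (p , q) → l ≢ j → l ≢ q →
      InRow l q E₁ k → k ≢ i → Free (i , l) ⊎ Free (p , l) ⊎ Free (k , j)
    opposite-of-pair e∈E₂ ends l≢j l≢q (kl , kq) k≢i
      with opposite-of-1-edge e∈E₂ ends kl k≢i (λ { refl → ends∉E₁ e∈E₂ (ends-swap ends) kq }) l≢j l≢q
    ... | inj₁ free               = inj₁ free
    ... | inj₂ (inj₁ free)        = inj₂ (inj₁ free)
    ... | inj₂ (inj₂ (inj₁ free)) = inj₂ (inj₂ free)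
    ... | inj₂ (inj₂ (inj₂ free)) = ⊥-elim (free (inj₁ kq))

    -- The 1-edge of the row lies in the remaining column `l`. Applying (W3) to the row of the pair
    -- `l , q` gives a free cell in column `j`, and the pair `l , j` gives one in column `q`.
    not-row-degenerate : ∀ {e i j p q} → e List.∈ E₂ → Ends e (i , j) (p , q) → i ≢ p
    not-row-degenerate {e} {i} {j} {.i} {q} e∈E₂ ends refl = j≢q
      (free-column (proj₂ (free-at ends l≢j l≢q)) (proj₂ (free-at (ends-swap ends) l≢q l≢j)))
      where
      j≢q : j ≢ q
      j≢q refl = ends-distinct ends refl
      l = proj₁ (row-nonempty i)
      il = proj₂ (row-nonempty i)
      l≢j : l ≢ j
      l≢j l≡j = ends∉E₁ e∈E₂ ends (subst (λ c → (i , c) ∈ᴳ E₁) l≡j il)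
      l≢q : l ≢ q
      l≢q l≡q = ends∉E₁ e∈E₂ (ends-swap ends) (subst (λ c → (i , c) ∈ᴳ E₁) l≡q il)
      free-at : ∀ {j q} → Ends e (i , j) (i , q) → l ≢ j → l ≢ q → ∃ λ k → Free (k , j)
      free-at {j} {q} ends l≢j l≢q with rowWith l q l≢q
      ... | k , kl , kq with opposite-of-pair e∈E₂ ends l≢j l≢q (kl , kq) (λ { refl → ends∉E₁ e∈E₂ (ends-swap ends) kq })
      ...   | inj₁ free        = ⊥-elim (free (inj₁ il))
      ...   | inj₂ (inj₁ free) = ⊥-elim (free (inj₁ il))
      ...   | inj₂ (inj₂ free) = k , free

    -- Applying (W3) to the row of the pair `l , j` gives a free cell in column `l`, for each of the
    -- two other columns `l`.
    not-col-degenerate : ∀ {e i j p q} → e List.∈ E₂ → Ends e (i , j) (p , q) → j ≢ q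
    not-col-degenerate {e} {i} {j} {p} {.j} e∈E₂ ends refl with third j j
    ... | l , l≢j , _ with third j l
    ...   | l′ , l′≢j , l′≢l = l′≢l (free-column (proj₂ (free-at l′ l′≢j)) (proj₂ (free-at l l≢j)))
      where
      free-at : ∀ l → l ≢ j → ∃ λ k → Free (k , l)
      free-at l l≢j with rowWith l j l≢j
      ... | k , kl , kj with opposite-of-pair e∈E₂ ends l≢j l≢j (kl , kj) (λ { refl → ends∉E₁ e∈E₂ ends kj })
      ...   | inj₁ free        = i , free
      ...   | inj₂ (inj₁ free) = p , free
      ...   | inj₂ (inj₂ free) = ⊥-elim (free (inj₁ kj))

    -- The cell left over in a row with two 1-edges; by `row-not-full` it is not a 1-edge itself.
    Gap : Cell 6 3 → Set
    Gap (i , j) = ∀ l → l ≢ j → (i , l) ∈ᴳ E₁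

    gap? : ∀ c → Dec (Gap c)
    gap? (i , j) = Fin.all? λ l → ¬? (l Fin.≟ j) →-dec ((i , l) ∈ᴳ? E₁)

    w2′-ends : ∀ {e i j p q} → e List.∈ E₂ → Ends e (i , j) (p , q) → (p , j) ∈ᴳ E₁ → ¬ (i , q) ∈ᴳ E₁
    w2′-ends e∈E₂ ends@(forward refl refl) pj iq =
      w2′ (_ , e∈E₂ , (not-row-degenerate e∈E₂ ends , not-col-degenerate e∈E₂ ends) , iq , pj)
    w2′-ends e∈E₂ ends@(backward refl refl) pj iq =
      w2′ (_ , e∈E₂ , (not-row-degenerate e∈E₂ (ends-swap ends) , not-col-degenerate e∈E₂ (ends-swap ends)) , pj , iq)

    gap-half : ∀ {e i j p q} → e List.∈ E₂ → Ends e (i , j) (p , q) → Gap (p , q) → ∃ λ c → Free c × col c ≢ q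
    gap-half {e} {i} {j} {p} {q} e∈E₂ ends gap with third j q
    ... | l , l≢j , l≢q with rowWith l q l≢q
    ...   | k , kl , kq with opposite-of-pair e∈E₂ ends l≢j l≢q (kl , kq)
                               -- If `k` were the row `i` of the other half, both opposite cells
                               -- would be 1-edges: `(p , j)` because of the gap, and `(i , q)`
                               -- because of the pair.
                               (λ { refl → w2′-ends e∈E₂ ends (gap j (not-col-degenerate e∈E₂ ends)) kq })
    ...     | inj₁ free        = _ , free , l≢q
    ...     | inj₂ (inj₁ free) = _ , free , l≢q
    ...     | inj₂ (inj₂ free) = _ , free , not-col-degenerate e∈E₂ ends

    module _ {e i j p q l} (e∈E₂ : e List.∈ E₂) (ends : Ends e (i , j) (p , q))
      (¬gap : ¬ Gap (i , j)) (¬gap′ : ¬ Gap (p , q)) (l≢j : l ≢ j) (l≢q : l ≢ q) where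

      private
        j≢q : j ≢ q
        j≢q = not-col-degenerate e∈E₂ ends

      not-pair : ∀ {i j q} → j ≢ q → l ≢ j → l ≢ q → ¬ Gap (i , j) → ∀ {k} → InRow l q E₁ k → k ≢ i
      not-pair {i} {j} {q} j≢q l≢j l≢q ¬gap (il , iq) refl = ¬gap λ o o≢j → case exhausted j q l o j≢q l≢j l≢q of λ where
        (inj₁ o≡j)        → contradiction o≡j o≢j
        (inj₂ (inj₁ refl)) → iq
        (inj₂ (inj₂ refl)) → il

      -- Otherwise the rows of the pairs `l , q` and `l , j` would give free cells in the two
      -- columns `j` and `q`.
      free-third : Free (i , l) ⊎ Free (p , l)
      free-third with rowWith l q l≢q | rowWith l j l≢j
      ... | k , kl , kq | k′ , k′l , k′j
        with opposite-of-pair e∈E₂ ends l≢j l≢q (kl , kq) (not-pair j≢q l≢j l≢q ¬gap (kl , kq))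
           | opposite-of-pair e∈E₂ (ends-swap ends) l≢q l≢j (k′l , k′j)
               (not-pair (λ eq → j≢q (sym eq)) l≢q l≢j ¬gap′ (k′l , k′j))
      ... | inj₁ free        | _                 = inj₁ free
      ... | inj₂ (inj₁ free) | _                 = inj₂ free
      ... | inj₂ (inj₂ free) | inj₁ free′        = ⊥-elim (l≢j (free-column free′ free))
      ... | inj₂ (inj₂ free) | inj₂ (inj₁ free′) = ⊥-elim (l≢j (free-column free′ free))
      ... | inj₂ (inj₂ free) | inj₂ (inj₂ free′) = ⊥-elim (j≢q (free-column free free′))

      -- The gap in column l is not the free cell, hence lies in a 2-edge,
      -- which yields a second free cell.
      no-gap-impossible : ⊥
      no-gap-impossible with rowWith j q j≢q
      ... | k , kj , kq with occupied? G (k , l)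
      ...   | no free = Sum.[ clash i (λ { refl → ends∉E₁ e∈E₂ ends kj }) , clash p (λ { refl → ends∉E₁ e∈E₂ (ends-swap ends) kq }) ] free-third
        where
        clash : ∀ r → k ≢ r → ¬ Free (r , l)
        clash r k≢r free′ = k≢r (cong row (free-unique free free′))
      ...   | yes (inj₁ kl) = row-not-full k λ o → case exhausted j q l o j≢q l≢j l≢q of λ where
        (inj₁ refl)        → kj
        (inj₂ (inj₁ refl)) → kq
        (inj₂ (inj₂ refl)) → kl
      ...   | yes (inj₂ (f , f∈E₂ , kl∈f)) with half-ends f kl∈f
      ...     | (_ , _) , ends′ with gap-half f∈E₂ (ends-swap ends′) (λ o o≢l → case exhausted j q l o j≢q l≢j l≢q of λ where
                  (inj₁ refl)        → kj
                  (inj₂ (inj₁ refl)) → kq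
                  (inj₂ (inj₂ o≡l))  → contradiction o≡l o≢l)
      ...       | c , free , c≢l = Sum.[ (λ free′ → c≢l (free-column free free′)) , (λ free′ → c≢l (free-column free free′)) ] free-third

    some-gap : ∀ {e} → e List.∈ E₂ → ∃ λ c → HalfOf e c × Gap c
    some-gap {e} e∈E₂ with gap? (half₁ e) | gap? (half₂ e)
    ... | yes gap | _        = half₁ e , inj₁ refl , gap
    ... | no _    | yes gap  = half₂ e , inj₂ refl , gap
    ... | no ¬gap | no ¬gap′ with third (col (half₁ e)) (col (half₂ e))
    ...   | l , l≢j , l≢q = ⊥-elim (no-gap-impossible e∈E₂ (forward refl refl) ¬gap ¬gap′ l≢j l≢q)

    -- Two such rows would have 1-edges in the same two columns, which form a C₄.
    gap-unique : ∀ {c d} → Gap c → Gap d → col c ≡ col d → c ≡ d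
    gap-unique {i , j} {k , .j} gap gap′ refl = decidable-stable ((i , j) ≟ᶜ (k , j)) λ c≢d →
      let l , l≢j , _ = third j j ; l′ , l′≢j , l′≢l = third j l in
      c₄-free (i , k , l , l′ , (λ { refl → c≢d refl }) , (λ l≡l′ → l′≢l (sym l≡l′)) ,
        gap l l≢j , gap l′ l′≢j , gap′ l l≢j , gap′ l′ l′≢j)

    -- Among four 2-edges, two have gap halves in the same one of the three columns. These halves
    -- coincide by `gap-unique`, against (S).
    impossible : ⊥
    impossible with Fin.pigeonhole 4≤E₂ (λ a → col (proj₁ (some-gap (∈-lookup {xs = E₂} a))))
    ... | a , b , a<b , eq = allPairs-lookup E₂-isSet a<b (shared-half (∈-lookup a) (∈-lookup b) c∈e
            (subst (HalfOf (List.lookup E₂ b)) (sym (gap-unique gap gap′ eq)) c∈f))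
      where
      c∈e = proj₁ (proj₂ (some-gap (∈-lookup {xs = E₂} a)))
      gap = proj₂ (proj₂ (some-gap (∈-lookup {xs = E₂} a)))
      c∈f = proj₁ (proj₂ (some-gap (∈-lookup {xs = E₂} b)))
      gap′ = proj₂ (proj₂ (some-gap (∈-lookup {xs = E₂} b)))

  module Strict (condition2 : Condition2 G) (condition3 : Condition3 G) (3≤E₂ : 3 ≤ length E₂) where

    Full : Fin 6 → Set
    Full i = ∀ l → Occupied G (i , l)

    full? : ∀ i → Dec (Full i)
    full? i = Fin.all? λ l → occupied? G (i , l)

    not-full : ∀ {i} → ¬ Full i → ∃ λ l → Free (i , l)
    not-full {i} = Fin.¬∀⟶∃¬ 3 (λ l → Occupied G (i , l)) (λ l → occupied? G (i , l))

    -- Four unoccupied cells and six halves exceed the nine cells outside `E₁`.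
    four-free-rows : (r : Fin 4 → Fin 6) → (∀ {a b} → r a ≡ r b → a ≡ b) → ¬ (∀ a → ∃ λ l → Free (r a , l))
    four-free-rows r r-injective free = ℕ.<⇒≱ (ℕ.n<1+n 9) (ℕ.≤-trans (ℕ.+-monoʳ-≤ 4 (ℕ.*-monoʳ-≤ 2 3≤E₂))
      (few-free {tabulate cell} (Unique.tabulate⁺ {f = cell} (λ {a} {b} eq → r-injective {a} {b} (cong row eq))) (All.tabulate⁺ {f = cell} λ a → proj₂ (free a))))
      where
      cell : Fin 4 → Cell 6 3
      cell a = r a , proj₁ (free a)

    -- Of four rows other than `i` and `p`, at least one has no unoccupied cell.
    full-row-avoiding : ∀ i p → ∃ λ k → k ≢ i × k ≢ p × Full k
    full-row-avoiding i p with avoiding i p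
    ... | r , r-injective , avoids with Fin.any? (λ a → full? (r a))
    ...   | yes (a , full) = r a , proj₁ (avoids a) , proj₂ (avoids a) , full
    ...   | no none = ⊥-elim (four-free-rows r r-injective λ a → not-full λ full → none (a , full))

    -- A full row elsewhere supplies three of the five cells of Condition 3, so the two remaining
    -- ones cannot both be occupied.
    third-column-free : ∀ {e i j p q l} → e List.∈ E₂ → Ends e (i , j) (p , q) → l ≢ j → l ≢ q →
      Occupied G (i , l) → ¬ Occupied G (p , l)
    third-column-free {i = i} {p = p} e∈E₂ ends l≢j l≢q il pl with full-row-avoiding i p
    third-column-free e∈E₂ (forward refl refl) l≢j l≢q il pl | k , k≢i , k≢p , full =
      condition3 (_ , e∈E₂ , k , _ , k≢i , k≢p , l≢j , l≢q , full _ , full _ , full _ , il , pl)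
    third-column-free e∈E₂ (backward refl refl) l≢j l≢q il pl | k , k≢i , k≢p , full =
      condition3 (_ , e∈E₂ , k , _ , k≢p , k≢i , l≢q , l≢j , full _ , full _ , full _ , pl , il)

    -- The 1-edge of the row would serve as the third-column cell for both halves.
    not-row-degenerate : ∀ {e i j p q} → e List.∈ E₂ → Ends e (i , j) (p , q) → i ≢ p
    not-row-degenerate {i = i} e∈E₂ ends refl with row-nonempty i
    ... | l , il = third-column-free e∈E₂ ends (λ { refl → ends∉E₁ e∈E₂ ends il })
      (λ { refl → ends∉E₁ e∈E₂ (ends-swap ends) il }) (inj₁ il) (inj₁ il)

    opposite-free : ∀ {e i j p q} → e List.∈ E₂ → Ends e (i , j) (p , q) → j ≢ q →
      Occupied G (i , q) → ¬ Occupied G (p , j)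
    opposite-free e∈E₂ ends@(forward refl refl) j≢q iq pj =
      condition2 (_ , e∈E₂ , (not-row-degenerate e∈E₂ ends , j≢q) , iq , pj)
    opposite-free e∈E₂ ends@(backward refl refl) j≢q iq pj =
      condition2 (_ , e∈E₂ , (not-row-degenerate e∈E₂ (ends-swap ends) , λ eq → j≢q (sym eq)) , pj , iq)

    -- The row of the other half holds a 1-edge, either in the column of the given half or in a
    -- column of neither. If the given row were full, the first case would violate Condition 2 and
    -- the second Condition 3.
    half-row-not-full : ∀ {e c} → e List.∈ E₂ → HalfOf e c → ¬ Full (row c)
    half-row-not-full {e} {i , j} e∈E₂ c∈e full with half-ends e c∈e
    ... | (p , q) , ends with row-nonempty p
    ...   | l , pl with l Fin.≟ q | l Fin.≟ j
    ...     | yes refl | _        = ends∉E₁ e∈E₂ (ends-swap ends) pl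
    ...     | no l≢q   | yes refl = opposite-free e∈E₂ ends l≢q (full q) (inj₁ pl)
    ...     | no l≢q   | no l≢j   = third-column-free e∈E₂ ends l≢j l≢q (full l) (inj₁ pl)

    -- A row with two halves would hold a 1-edge and a free cell as well.
    halves-in-distinct-rows : ∀ {e f c d} → e List.∈ E₂ → f List.∈ E₂ → HalfOf e c → HalfOf f d → c ≢ d → row c ≢ row d
    halves-in-distinct-rows {e} {f} {i , j} {.i , l} e∈E₂ f∈E₂ c∈e d∈f c≢d refl
      with row-nonempty i | not-full (half-row-not-full e∈E₂ c∈e)
    ... | o , io | u , free = case exhausted j l o u (λ { refl → c≢d refl })
            (λ { refl → half∉E₁ e∈E₂ c∈e io }) (λ { refl → half∉E₁ f∈E₂ d∈f io }) of λ where
        (inj₁ refl)        → free (inj₂ (e , e∈E₂ , c∈e))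
        (inj₂ (inj₁ refl)) → free (inj₂ (f , f∈E₂ , d∈f))
        (inj₂ (inj₂ refl)) → free (inj₁ io)

    -- There are at least six halves, all in distinct rows that are not full; four of them already
    -- contradict `four-free-rows`.
    impossible : ⊥
    impossible = four-free-rows (λ a → row (half a)) row-injective free
      where
      4≤halves : 4 ≤ length (halves E₂)
      4≤halves = subst (4 ≤_) (sym (length-halves E₂)) (ℕ.≤-trans (ℕ.m≤n+m 4 2) (ℕ.*-monoʳ-≤ 2 3≤E₂))

      half : Fin 4 → Cell 6 3
      half a = List.lookup (halves E₂) (inject≤ a 4≤halves)

      half-edge : ∀ a → ∃ λ e → e List.∈ E₂ × HalfOf e (half a)
      half-edge a = ∈-halves (∈-lookup (inject≤ a 4≤halves))

      free : ∀ a → ∃ λ l → Free (row (half a) , l)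
      free a = let e , e∈E₂ , c∈e = half-edge a in not-full (half-row-not-full e∈E₂ c∈e)

      row-injective : ∀ {a b} → row (half a) ≡ row (half b) → a ≡ b
      row-injective {a} {b} eq = Fin.inject≤-injective 4≤halves 4≤halves a b
        (unique-lookup-injective (halves-unique E₂-isSet (proj₂ condS))
          (decidable-stable (half a ≟ᶜ half b) λ a≢b →
            let e , e∈E₂ , c∈e = half-edge a ; f , f∈E₂ , d∈f = half-edge b in
            halves-in-distinct-rows e∈E₂ f∈E₂ c∈e d∈f a≢b eq))

-- The Zarankiewicz number, both augmented numbers and the SOS rank in size 6 × 3

zarankiewicz : IsZarankiewicz 6 3 9
zarankiewicz = (extremal₉ , extremal₉-C₄-free , refl) , λ l (G , c₄-free , eq) →
  subst (_≤ 9) eq (ℕ.m+n≤o⇒m≤o (edgeCount G) (edgeCount≤ G c₄-free))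

limited⇒9 : ∀ G → Limited G → edgeCount (AugmentedGraph.E₁ G) ≡ 9
limited⇒9 G (attained , maximal) = ℕ.≤-antisym (proj₂ zarankiewicz _ attained) (maximal 9 (proj₁ zarankiewicz))

totalEdges≤ : ∀ (G : AugmentedGraph 6 3) {t l} → edgeCount (AugmentedGraph.E₁ G) ≡ 9 →
  ¬ suc t ≤ length (AugmentedGraph.E₂ G) → totalEdges G ≡ l → l ≤ 9 + t
totalEdges≤ G {t} edges₉ few refl = subst (λ k → k + length (AugmentedGraph.E₂ G) ≤ 9 + t) (sym edges₉)
  (ℕ.+-monoʳ-≤ 9 (ℕ.≮⇒≥ few))

zwL≡12 : Is-zwL 6 3 12
zwL≡12 = (weak₁₂ , zarankiewicz , weak₁₂-weakAdmissible , refl) ,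
  λ l (G , limited , (condS , w1 , _ , w2′ , w3) , total) → let edges₉ = limited⇒9 G limited in
    totalEdges≤ G edges₉ (Bounds.Weak.impossible G edges₉ condS w1 w2′ w3) total

zL≡11 : Is-zL 6 3 11
zL≡11 = (admissible₁₁ , zarankiewicz , admissible₁₁-admissible , refl) ,
  λ l (G , limited , (condS , w1 , condition2 , condition3) , total) → let edges₉ = limited⇒9 G limited in
    totalEdges≤ G edges₉ (Bounds.Strict.impossible G edges₉ condS w1 condition2 condition3) total

rank₁₂ : ∃ λ (P : BiquadraticForm 6 3) → IsSOSRank P 12
rank₁₂ = RealForms.labelForm-rank label₁₂ representative label-representative representatives-determined

theorem14 : (∃ λ (G : AugmentedGraph 6 3) → Limited G × WeakAdmissible G × totalEdges G ≡ 12)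
    × (∃₂ λ zwL zL → Is-zwL 6 3 zwL × Is-zL 6 3 zL × zwL ≥ 12 × 12 > zL × zL ≡ 11)
    × (∃₂ λ (P : BiquadraticForm 6 3) r → IsSOSRank P r × r ≥ 12)
    × (∀ bsr → IsBSR 6 3 bsr → bsr ≥ 12)
theorem14 =
  (weak₁₂ , zarankiewicz , weak₁₂-weakAdmissible , refl) ,
  (12 , 11 , zwL≡12 , zL≡11 , ℕ.≤-refl , ℕ.≤-refl , refl) ,
  (proj₁ rank₁₂ , 12 , proj₂ rank₁₂ , ℕ.≤-refl) ,
  λ bsr (_ , maximal) → maximal 12 rank₁₂
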